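{- Let $n$ be a positive integer, let $\mathcal{Y}\subset Fl(\mathbb{C}^n)$ be the Peterson variety of type $A_{n-1}$, and let $x_1,\ldots,x_n\in H^2(\mathcal{Y};\mathbb{Q})$ be the (negatives of the) first Chern classes of the tautological line bundles. For $J\subseteq\{1,\ldots,n-1\}$ put $x_J=\prod_{j\in J}x_j$, and for $J,K\subseteq\{1,\ldots,n-1\}$ let $c_{J,K}^L\in\mathbb{Q}$ ($L\subseteq\{1,\ldots,n-1\}$) be the structure constants determined by $$x_J\cdot x_K=\sum_{L\subseteq\{1,\ldots,n-1\}}c_{J,K}^L\,x_L\quad\text{in } H^*(\mathcal{Y};\mathbb{Q}).$$ Then $c_{J,K}^L\in\mathbb{Z}$ for all $J,K,L\subseteq\{1,\ldots,n-1\}$.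
   Context: $Fl(\mathbb{C}^n)$ is the variety of full flags $V_\bullet=(0=V_0\subset V_1\subset\cdots\subset V_n=\mathbb{C}^n)$, $\dim_{\mathbb{C}}V_i=i$. Let $N$ be the $n\times n$ nilpotent matrix consisting of a single Jordan block. The Peterson variety is $\mathcal{Y}=\{V_\bullet\in Fl(\mathbb{C}^n)\mid NV_i\subset V_{i+1}\ (1\le i\le n-1)\}$. Let $U_i$ be the tautological rank-$i$ vector bundle over $Fl(\mathbb{C}^n)$ (fiber $V_i$ over $V_\bullet$), and let $x_i\in H^2(\mathcal{Y};\mathbb{Q})$ be the restriction to $\mathcal{Y}$ of $-c_1(U_i/U_{i-1})$, $1\le i\le n$. Standing identification (known, due to Fukukawa–Harada–Masuda): $H^*(\mathcal{Y};\mathbb{Q})\cong\mathbb{Q}[x_1,\ldots,x_n]/J_x$, with $x_i$ corresponding to the class $x_i$, where $J_x$ is the ideal generated by $(x_1+\cdots+x_k)(x_k-x_{k+1})$ for $1\le k\le n-1$ and $x_1+\cdots+x_n$. The constants $c_{J,K}^L$ are well defined because (known, due to Harada–Horiguchi–Murai–Precup–Tymoczko) the square free monomials $x_L$, $L\subseteq\{1,\ldots,n-1\}$ (with $x_\emptyset=1$), form a basis of $H^*(\mathcal{Y};\mathbb{Q})$ over $\mathbb{Q}$, called the tautological basis. -}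

module Defs where

open import Data.Bool.Base using (if_then_else_)
open import Data.Fin.Base using (Fin; zero; suc; inject₁)
open import Data.Fin.Properties using (_≤?_) renaming (_≟_ to _≟ᶠ_)
open import Data.Fin.Subset using (Subset; inside; outside)
open import Data.Fin.Subset.Properties using (_∈?_)
open import Data.List.Base using (List; []; _∷_; [_]; _++_; map; foldr; filter; allFin; cartesianProductWith)
open import Data.Nat.Base as ℕ using (ℕ; zero; suc)
import Data.Nat.Properties as ℕ
open import Data.Product.Base using (_×_; _,_; ∃-syntax)
open import Data.Rational.Base as ℚ using (ℚ; 0ℚ; 1ℚ)
open import Data.Vec.Base as Vec using (Vec)
open import Data.Vec.Properties using (≡-dec)
open import Level using (0ℓ)
open import Relation.Binary.PropositionalEquality.Core using (_≡_)
open import Relation.Nullary.Decidable.Core using (does)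
open import Relation.Unary using (Pred)

private
  variable
    n : ℕ

Exponent : ℕ → Set
Exponent n = Vec ℕ n

-- A polynomial is a formal finite sum of terms q·x^e.  Exponents may be
-- repeated and coefficients may vanish, so the equality of polynomials is
-- _≈_ below, not _≡_.
Poly : ℕ → Set
Poly n = List (ℚ × Exponent n)

coeff : Poly n → Exponent n → ℚ
coeff []            e = 0ℚ
coeff ((q , d) ∷ p) e =
  (if does (≡-dec ℕ._≟_ d e) then q else 0ℚ) ℚ.+ coeff p e

infix 4 _≈_
_≈_ : Poly n → Poly n → Set
p ≈ q = ∀ e → coeff p e ≡ coeff q e

const : ℚ → Poly n
const q = [ q , Vec.replicate _ 0 ]

var : Fin n → Poly n
var i = [ 1ℚ , Vec.tabulate (λ j → if does (i ≟ᶠ j) then 1 else 0) ]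

infixl 6 _⊕_ _⊖_
infixl 7 _⊗_

_⊕_ : Poly n → Poly n → Poly n
_⊕_ = _++_

_⊗_ : Poly n → Poly n → Poly n
_⊗_ = cartesianProductWith λ (q , d) (r , e) → q ℚ.* r , Vec.zipWith ℕ._+_ d e

_⊖_ : Poly n → Poly n → Poly n
p ⊖ q = p ⊕ const (ℚ.- 1ℚ) ⊗ q

∑ : List (Poly n) → Poly n
∑ = foldr _⊕_ (const 0ℚ)

∏ : List (Poly n) → Poly n
∏ = foldr _⊗_ (const 1ℚ)

data Ideal (G : Pred (Poly n) 0ℓ) : Pred (Poly n) 0ℓ where
  gen  : ∀ {p} → G p → Ideal G p
  zero : Ideal G (const 0ℚ)
  add  : ∀ {p q} → Ideal G p → Ideal G q → Ideal G (p ⊕ q)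
  mul  : ∀ r {p} → Ideal G p → Ideal G (r ⊗ p)
  resp : ∀ {p q} → p ≈ q → Ideal G p → Ideal G q

-- H*(𝒴;ℚ) for the Peterson variety 𝒴 ⊂ Fl(ℂⁿ), n = suc m, is taken to be
-- ℚ[x₁,…,xₙ]/Jₓ, by the presentation of Fukukawa–Harada–Masuda in which xᵢ
-- is the restriction to 𝒴 of -c₁(Uᵢ/Uᵢ₋₁).
--
-- Indices are shifted by one: the class xᵢ is var of the element of
-- Fin (suc m) whose value is i - 1, and Fin m stands for {1,…,n-1}.  Thus
-- for k : Fin m, x_k is var (inject₁ k) and x_{k+1} is var (suc k).

-- x₁ + ⋯ + x_k
partialSum : ∀ {m} → Fin m → Poly (suc m)
partialSum {m} k = ∑ (map var (filter (_≤? k) (allFin (suc m))))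

data Generator (m : ℕ) : Pred (Poly (suc m)) 0ℓ where
  quadratic : (k : Fin m) →
              Generator m (partialSum k ⊗ (var (inject₁ k) ⊖ var (suc k)))
  linear    : Generator m (∑ (map var (allFin (suc m))))

Jₓ : (m : ℕ) → Pred (Poly (suc m)) 0ℓ
Jₓ m = Ideal (Generator m)

infix 4 _≈ᴴ_
_≈ᴴ_ : ∀ {m} → Poly (suc m) → Poly (suc m) → Set
_≈ᴴ_ {m} p q = Jₓ m (p ⊖ q)

x[_] : ∀ {m} → Subset m → Poly (suc m)
x[_] {m} J = ∏ (map (λ j → var (inject₁ j)) (filter (_∈? J) (allFin m)))

-- Every subset occurs exactly once.
allSubsets : ∀ m → List (Subset m)
allSubsets zero    = [ Vec.[] ]
allSubsets (suc m) = map (outside Vec.∷_) (allSubsets m) ++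
                     map (inside  Vec.∷_) (allSubsets m)

-- c is unique for given J and K, since the x[ L ] form a basis of H*(𝒴;ℚ).
IsStructureConstants : ∀ {m} → Subset m → Subset m → (Subset m → ℚ) → Set
IsStructureConstants {m} J K c =
  x[ J ] ⊗ x[ K ] ≈ᴴ ∑ (map (λ L → const (c L) ⊗ x[ L ]) (allSubsets m))

IsInteger : ℚ → Set
IsInteger q = ∃[ z ] q ≡ z ℚ./ 1

{-# OPTIONS --safe #-}

-- The ring ℚ[x₁,…,xₙ]/Jₓ is made to act on functions ψ of subsets K of the
-- interior vertices 1,…,n-1 of the path 0 – 1 – ⋯ – n, where xᵢ is the edge
-- from i-1 to i.  The vertices in K glue the edges into blocks, and
--
--   (xᵢ ψ)(K) = (ψ(K ∪ {b}) - ψ(K ∪ {a})) / (b - a),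
--
-- where a and b are the ends of the block of i and ψ(K ∪ {0}) = ψ(K ∪ {n}) = 0.
-- Up to duality this is multiplication by xᵢ in the basis ∏_{k ∈ K} (x₁ + ⋯ + x_k).
-- The defining relations hold for these operators, and they commute because
-- i ↦ xᵢ ψ is determined by being constant on blocks together with its partial
-- sums at the block ends.
--
-- Let w(K) be the product of (|β| - 1)! over the blocks β.  The functions with
-- w(K) ∣ ψ(K) for all K are preserved, since the coefficients become binomial.
-- On them ψ ↦ (x_L ψ)(∅) is unitriangular with respect to ψ ↦ ψ(L)/w(L) in the
-- colexicographic order.  Evaluating the defining equation of the structure
-- constants at such ψ therefore shows, by descending induction, that all c_L
-- are integers.

module Submission where

open import Defs
open import Algebra.Properties.Group using (x∙y⁻¹≈ε⇒x≈y)
open import Data.Bool.Base using (Bool; true; false; if_then_else_)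
import Data.Bool.Properties as Bool
open import Data.Fin.Base using (Fin; zero; suc; inject₁; fromℕ; toℕ)
open import Data.Fin.Properties using (_≤?_) renaming (_≟_ to _≟ᶠ_)
open import Data.Fin.Subset using (Subset; ⊥)
open import Data.Fin.Subset.Properties using (_∈?_)
open import Data.Integer.Base as ℤ using (ℤ; 1ℤ)
import Data.Integer.Properties as ℤ
open import Data.List.Base using (List; []; _∷_; _++_; map; foldr; filter; deduplicate; allFin) renaming (tabulate to tabulateᴸ)
open import Data.List.Membership.Propositional using (_∈_; _∉_)
open import Data.List.Membership.Propositional.Properties using (∈-deduplicate⁺; ∈-++⁺ˡ; ∈-++⁺ʳ)
open import Data.List.Properties using (map-tabulate; foldr-map)
open import Data.List.Relation.Unary.All as All using (All; []; _∷_)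
import Data.List.Relation.Unary.All.Properties as All
open import Data.List.Relation.Unary.AllPairs as AllPairs using (AllPairs; []; _∷_)
import Data.List.Relation.Unary.AllPairs.Properties as AllPairs
open import Data.List.Relation.Unary.Any using (here; there)
open import Data.List.Relation.Unary.Unique.DecPropositional.Properties using (deduplicate-!)
open import Data.List.Relation.Unary.Unique.Propositional using (Unique)
open import Data.Nat.Base as ℕ using (ℕ; zero; suc; _!; _^_; _≤_; _<_; z≤n; s≤s; NonZero)
open import Data.Nat.Combinatorics using (k![n∸k]!∣n!)
open import Data.Nat.Divisibility as ℕ using (_∣_; divides)
import Data.Nat.Properties as ℕ
open import Data.Nat.Solver using () renaming (module +-*-Solver to ℕ-Solver)
open import Data.Product.Base using (_,_; proj₂)
open import Data.Rational.Base as ℚ using (ℚ; 0ℚ; 1ℚ; _+_; _*_; -_; _/_; toℚᵘ)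
open import Data.Rational.Properties as ℚ using (toℚᵘ-injective; toℚᵘ-fromℚᵘ; toℚᵘ-homo-+; toℚᵘ-homo-*; toℚᵘ-homo‿-)
open import Data.Rational.Solver using (module +-*-Solver)
open import Data.Rational.Unnormalised.Base as ℚᵘ using (mkℚᵘ; *≡*; _≃_)
import Data.Rational.Unnormalised.Properties as ℚᵘ
open import Data.Unit.Base using (⊤; tt)
open import Data.Vec.Base using ([]; _∷_; zipWith; tabulate; replicate; lookup; _[_]≔_)
open import Data.Vec.Properties using (≡-dec; lookup-replicate; lookup∘update; lookup∘update′)
open import Function.Base using (_∘_; id)
open import Level using (0ℓ)
open import Relation.Binary.Definitions using (DecidableEquality; tri<; tri≈; tri>)
open import Relation.Binary.PropositionalEquality using (_≡_; _≢_; _≗_; refl; sym; trans; cong; cong₂; subst; subst₂; module ≡-Reasoning)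
open import Relation.Nullary using (yes; no; does; contradiction)
open import Relation.Unary using (Pred; Decidable)
open +-*-Solver using (solve; _:=_; _:+_; _:*_; :-_; con)
open ℕ-Solver using () renaming (solve to solveℕ; _:*_ to _:×_; _:=_ to _:≡_)

-- Integers inside ℚ

ι : ℤ → ℚ
ι z = z / 1

-- The division `_/_` on `ℚ` reduces by a gcd. Over the unnormalised rationals the fraction is
-- available as written, so the identities below become identities of integers.
toℚᵘ-/ : ∀ z d → toℚᵘ (z / suc d) ≃ mkℚᵘ z d
toℚᵘ-/ z d = toℚᵘ-fromℚᵘ (mkℚᵘ z d)

ι-+ : ∀ a b → ι (a ℤ.+ b) ≡ ι a + ι b
ι-+ a b = toℚᵘ-injective (begin
  toℚᵘ (ι (a ℤ.+ b))         ≈⟨ toℚᵘ-/ (a ℤ.+ b) 0 ⟩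
  mkℚᵘ (a ℤ.+ b) 0           ≈⟨ *≡* (cong (ℤ._* 1ℤ) (sym (cong₂ ℤ._+_ (ℤ.*-identityʳ a) (ℤ.*-identityʳ b)))) ⟩
  mkℚᵘ a 0 ℚᵘ.+ mkℚᵘ b 0     ≈⟨ ℚᵘ.+-cong (toℚᵘ-/ a 0) (toℚᵘ-/ b 0) ⟨
  toℚᵘ (ι a) ℚᵘ.+ toℚᵘ (ι b) ≈⟨ toℚᵘ-homo-+ (ι a) (ι b) ⟨
  toℚᵘ (ι a + ι b)           ∎)
  where open ℚᵘ.≃-Reasoning

ι-* : ∀ a b → ι (a ℤ.* b) ≡ ι a * ι b
ι-* a b = toℚᵘ-injective (begin
  toℚᵘ (ι (a ℤ.* b))         ≈⟨ toℚᵘ-/ (a ℤ.* b) 0 ⟩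
  mkℚᵘ a 0 ℚᵘ.* mkℚᵘ b 0     ≈⟨ ℚᵘ.*-cong (toℚᵘ-/ a 0) (toℚᵘ-/ b 0) ⟨
  toℚᵘ (ι a) ℚᵘ.* toℚᵘ (ι b) ≈⟨ toℚᵘ-homo-* (ι a) (ι b) ⟨
  toℚᵘ (ι a * ι b)           ∎)
  where open ℚᵘ.≃-Reasoning

ι-neg : ∀ a → ι (ℤ.- a) ≡ - ι a
ι-neg a = toℚᵘ-injective (begin
  toℚᵘ (ι (ℤ.- a))   ≈⟨ toℚᵘ-/ (ℤ.- a) 0 ⟩
  ℚᵘ.- mkℚᵘ a 0      ≈⟨ ℚᵘ.-‿cong (toℚᵘ-/ a 0) ⟨
  ℚᵘ.- toℚᵘ (ι a)    ≈⟨ toℚᵘ-homo‿- (ι a) ⟨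
  toℚᵘ (- ι a)       ∎)
  where open ℚᵘ.≃-Reasoning

ν : ℕ → ℚ
ν k = ι (ℤ.+ k)

ν-* : ∀ a b → ν (a ℕ.* b) ≡ ν a * ν b
ν-* a b = trans (cong ι (ℤ.pos-* a b)) (ι-* (ℤ.+ a) (ℤ.+ b))

ν-suc : ∀ k → ν (suc k) ≡ 1ℚ + ν k
ν-suc k = ι-+ (ℤ.+ 1) (ℤ.+ k)

recip : ℕ → ℚ
recip p = ℤ.+ 1 / suc p

recip-inverse : ∀ p → recip p * ν (suc p) ≡ 1ℚ
recip-inverse p = toℚᵘ-injective (begin
  toℚᵘ (recip p * ν (suc p))           ≈⟨ toℚᵘ-homo-* (recip p) (ν (suc p)) ⟩
  toℚᵘ (recip p) ℚᵘ.* toℚᵘ (ν (suc p)) ≈⟨ ℚᵘ.*-cong (toℚᵘ-/ (ℤ.+ 1) p) (toℚᵘ-/ (ℤ.+ suc p) 0) ⟩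
  mkℚᵘ (ℤ.+ 1) p ℚᵘ.* mkℚᵘ (ℤ.+ suc p) 0
    ≈⟨ *≡* (trans (ℤ.*-identityʳ _) (trans (ℤ.*-identityˡ _)
         (sym (trans (ℤ.*-identityˡ _) (cong ℤ.+_ (ℕ.*-identityʳ (suc p))))))) ⟩
  toℚᵘ 1ℚ                              ∎)
  where open ℚᵘ.≃-Reasoning

ν-cancelˡ : ∀ k .{{_ : NonZero k}} {x y} → ν k * x ≡ ν k * y → x ≡ y
ν-cancelˡ (suc p) {x} {y} eq = begin
  x                         ≡⟨ undo x ⟨
  recip p * (ν (suc p) * x) ≡⟨ cong (recip p *_) eq ⟩
  recip p * (ν (suc p) * y) ≡⟨ undo y ⟩
  y                         ∎
  where
  open ≡-Reasoning
  undo : ∀ x → recip p * (ν (suc p) * x) ≡ x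
  undo x = trans (sym (ℚ.*-assoc (recip p) (ν (suc p)) x))
    (trans (cong (_* x) (recip-inverse p)) (ℚ.*-identityˡ x))

-- Divisibility of rationals by natural numbers

infix 4 _∣ℚ_
record _∣ℚ_ (k : ℕ) (x : ℚ) : Set where
  constructor multiple
  field
    quotient : ℤ
    equality : x ≡ ι quotient * ν k

∣ℚ-0 : ∀ k → k ∣ℚ 0ℚ
∣ℚ-0 k = multiple (ℤ.+ 0) (sym (ℚ.*-zeroˡ (ν k)))

∣ℚ-+ : ∀ {k x y} → k ∣ℚ x → k ∣ℚ y → k ∣ℚ x + y
∣ℚ-+ {k} (multiple a refl) (multiple b refl) = multiple (a ℤ.+ b)
  (sym (trans (cong (_* ν k) (ι-+ a b)) (ℚ.*-distribʳ-+ (ν k) (ι a) (ι b))))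

∣ℚ-neg : ∀ {k x} → k ∣ℚ x → k ∣ℚ - x
∣ℚ-neg {k} (multiple a refl) = multiple (ℤ.- a)
  (trans (ℚ.neg-distribˡ-* (ι a) (ν k)) (cong (_* ν k) (sym (ι-neg a))))

∣ℚ-trans : ∀ {j k x} → j ℕ.∣ k → k ∣ℚ x → j ∣ℚ x
∣ℚ-trans {j} (divides d refl) (multiple a refl) = multiple (a ℤ.* ℤ.+ d) (begin
  ι a * ν (d ℕ.* j)   ≡⟨ cong (ι a *_) (ν-* d j) ⟩
  ι a * (ν d * ν j)   ≡⟨ ℚ.*-assoc (ι a) (ν d) (ν j) ⟨
  ι a * ν d * ν j     ≡⟨ cong (_* ν j) (ι-* a (ℤ.+ d)) ⟨
  ι (a ℤ.* ℤ.+ d) * ν j ∎)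
  where open ≡-Reasoning

-- Absorbs the denominator b - a of the operators: a factor `suc p` to spare in the divisor pays for
-- the division.
∣ℚ-recip : ∀ p {k x} → suc p ℕ.* k ∣ℚ x → k ∣ℚ recip p * x
∣ℚ-recip p {k} (multiple a refl) = multiple a (begin
  recip p * (ι a * ν (suc p ℕ.* k))    ≡⟨ cong (λ t → recip p * (ι a * t)) (ν-* (suc p) k) ⟩
  recip p * (ι a * (ν (suc p) * ν k))
    ≡⟨ solve 4 (λ r a s k → r :* (a :* (s :* k)) := r :* s :* (a :* k)) refl (recip p) (ι a) (ν (suc p)) (ν k) ⟩
  recip p * ν (suc p) * (ι a * ν k)    ≡⟨ cong (_* (ι a * ν k)) (recip-inverse p) ⟩
  1ℚ * (ι a * ν k)                     ≡⟨ ℚ.*-identityˡ _ ⟩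
  ι a * ν k                            ∎)
  where open ≡-Reasoning

1∣ℚ⇒IsInteger : ∀ {x} → 1 ∣ℚ x → IsInteger x
1∣ℚ⇒IsInteger (multiple z refl) = z , ℚ.*-identityʳ _

IsInteger-0 : IsInteger 0ℚ
IsInteger-0 = ℤ.+ 0 , refl

IsInteger-+ : ∀ {x y} → IsInteger x → IsInteger y → IsInteger (x + y)
IsInteger-+ (a , refl) (b , refl) = a ℤ.+ b , sym (ι-+ a b)

IsInteger-neg : ∀ {x} → IsInteger x → IsInteger (- x)
IsInteger-neg (a , refl) = ℤ.- a , sym (ι-neg a)

IsInteger-* : ∀ {x y} → IsInteger x → IsInteger y → IsInteger (x * y)
IsInteger-* (a , refl) (b , refl) = a ℤ.* b , sym (ι-* a b)

-- Polynomials in commuting operators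

_≟ᵉ_ : ∀ {n} → DecidableEquality (Exponent n)
_≟ᵉ_ = ≡-dec ℕ._≟_

sumOver : {A : Set} → List A → (A → ℚ) → ℚ
sumOver xs f = foldr (λ x s → f x + s) 0ℚ xs

sumOver-cong : {A : Set} (xs : List A) {f g : A → ℚ} → f ≗ g → sumOver xs f ≡ sumOver xs g
sumOver-cong []       eq = refl
sumOver-cong (x ∷ xs) eq = cong₂ _+_ (eq x) (sumOver-cong xs eq)

sumOver-+ : {A : Set} (xs : List A) (f g : A → ℚ) →
            sumOver xs (λ x → f x + g x) ≡ sumOver xs f + sumOver xs g
sumOver-+ []       f g = refl
sumOver-+ (x ∷ xs) f g = trans (cong (f x + g x +_) (sumOver-+ xs f g))
  (solve 4 (λ a b c d → a :+ b :+ (c :+ d) := a :+ c :+ (b :+ d)) refl (f x) (g x) (sumOver xs f) (sumOver xs g))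

linearExtension : ∀ {n} → (Exponent n → ℚ) → Poly n → ℚ
linearExtension f p = sumOver p (λ (q , d) → q * f d)

module _ {n : ℕ} (f : Exponent n → ℚ) where

  term : ℚ → Exponent n → Exponent n → ℚ
  term q d e = (if does (d ≟ᵉ e) then q else 0ℚ) * f e

  term-∉ : ∀ q d {E} → d ∉ E → sumOver E (term q d) ≡ 0ℚ
  term-∉ q d {[]}    d∉E = refl
  term-∉ q d {e ∷ E} d∉E with d ≟ᵉ e
  ... | yes refl = contradiction (here refl) d∉E
  ... | no  _    = trans (cong₂ _+_ (ℚ.*-zeroˡ (f e)) (term-∉ q d (d∉E ∘ there))) (ℚ.+-identityʳ 0ℚ)

  term-∈ : ∀ q d {E} → Unique E → d ∈ E → sumOver E (term q d) ≡ q * f d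
  term-∈ q d {e ∷ E} (e∉E ∷ u) d∈E with d ≟ᵉ e | d∈E
  ... | yes refl | _ =
    trans (cong (q * f d +_) (term-∉ q d (All.All¬⇒¬Any e∉E))) (ℚ.+-identityʳ _)
  ... | no  d≢e | here d≡e = contradiction d≡e d≢e
  ... | no  _   | there d∈ = trans (cong₂ _+_ (ℚ.*-zeroˡ (f e)) (term-∈ q d u d∈)) (ℚ.+-identityˡ _)

  -- Collecting equal exponents. `E` may be larger than the support of `p`, because two polynomials
  -- can be compared coefficient by coefficient only over a common list.
  linearExtension-coeff : ∀ {E} → Unique E → (p : Poly n) → (∀ {d} → d ∈ map proj₂ p → d ∈ E) →
                          sumOver E (λ e → coeff p e * f e) ≡ linearExtension f p
  linearExtension-coeff {E} u [] p⊆E =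
    trans (sumOver-cong E (λ e → ℚ.*-zeroˡ (f e))) (sum-zero E)
    where
    sum-zero : (E : List (Exponent n)) → sumOver E (λ _ → 0ℚ) ≡ 0ℚ
    sum-zero []      = refl
    sum-zero (_ ∷ E) = trans (ℚ.+-identityˡ _) (sum-zero E)
  linearExtension-coeff {E} u ((q , d) ∷ p) p⊆E = begin
    sumOver E (λ e → coeff ((q , d) ∷ p) e * f e)
      ≡⟨ sumOver-cong E (λ e → ℚ.*-distribʳ-+ (f e) (if does (d ≟ᵉ e) then q else 0ℚ) (coeff p e)) ⟩
    sumOver E (λ e → term q d e + coeff p e * f e)
      ≡⟨ sumOver-+ E (term q d) _ ⟩
    sumOver E (term q d) + sumOver E (λ e → coeff p e * f e)
      ≡⟨ cong₂ _+_ (term-∈ q d u (p⊆E (here refl))) (linearExtension-coeff u p (p⊆E ∘ there)) ⟩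
    q * f d + linearExtension f p ∎
    where open ≡-Reasoning

  linearExtension-cong : ∀ {p q} → p ≈ q → linearExtension f p ≡ linearExtension f q
  linearExtension-cong {p} {q} p≈q = begin
    linearExtension f p                 ≡⟨ linearExtension-coeff E! p (∈-deduplicate⁺ _≟ᵉ_ ∘ ∈-++⁺ˡ) ⟨
    sumOver E (λ e → coeff p e * f e)   ≡⟨ sumOver-cong E (λ e → cong (_* f e) (p≈q e)) ⟩
    sumOver E (λ e → coeff q e * f e)   ≡⟨ linearExtension-coeff E! q (∈-deduplicate⁺ _≟ᵉ_ ∘ ∈-++⁺ʳ (map proj₂ p)) ⟩
    linearExtension f q                 ∎
    where
    open ≡-Reasoning
    E : List (Exponent n)
    E = deduplicate _≟ᵉ_ (map proj₂ p ++ map proj₂ q)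
    E! : Unique E
    E! = deduplicate-! _≟ᵉ_ (map proj₂ p ++ map proj₂ q)

-- Linear operators and the action of polynomials through them

Op : Set → Set
Op A = (A → ℚ) → (A → ℚ)

record Linear {A : Set} (f : Op A) : Set where
  field
    resp-≗ : ∀ {φ ψ} → φ ≗ ψ → f φ ≗ f ψ
    resp-+ : ∀ φ ψ → f (λ a → φ a + ψ a) ≗ λ a → f φ a + f ψ a
    resp-* : ∀ c ψ → f (λ a → c * ψ a) ≗ λ a → c * f ψ a

  resp-0 : f (λ _ → 0ℚ) ≗ λ _ → 0ℚ
  resp-0 a = trans (resp-≗ (λ _ → sym (ℚ.*-zeroˡ 0ℚ)) a)
    (trans (resp-* 0ℚ (λ _ → 0ℚ) a) (ℚ.*-zeroˡ (f (λ _ → 0ℚ) a)))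

open Linear

Commute : {A : Set} → Op A → Op A → Set
Commute f g = ∀ ψ → f (g ψ) ≗ g (f ψ)

module _ {A : Set} where

  iterate : ℕ → Op A → Op A
  iterate zero    f ψ = ψ
  iterate (suc k) f ψ = f (iterate k f ψ)

  monomial : ∀ {n} → (Fin n → Op A) → Exponent n → Op A
  monomial T []       ψ = ψ
  monomial T (d ∷ ds) ψ = iterate d (T zero) (monomial (T ∘ suc) ds ψ)

  act : ∀ {n} → (Fin n → Op A) → Poly n → Op A
  act T p ψ a = linearExtension (λ d → monomial T d ψ a) p

  ∘-linear : {f g : Op A} → Linear f → Linear g → Linear (f ∘ g)
  ∘-linear F G .resp-≗ eq = resp-≗ F (resp-≗ G eq)
  ∘-linear F G .resp-+ φ ψ a = trans (resp-≗ F (resp-+ G φ ψ) a) (resp-+ F _ _ a)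
  ∘-linear F G .resp-* c ψ a = trans (resp-≗ F (resp-* G c ψ) a) (resp-* F c _ a)

  id-linear : Linear {A} (λ ψ → ψ)
  id-linear .resp-≗ eq      = eq
  id-linear .resp-+ φ ψ a   = refl
  id-linear .resp-* c ψ a   = refl

  iterate-linear : ∀ k {f} → Linear f → Linear (iterate k f)
  iterate-linear zero    F = id-linear
  iterate-linear (suc k) F = ∘-linear F (iterate-linear k F)

  monomial-linear : ∀ {n} {T : Fin n → Op A} → (∀ i → Linear (T i)) → ∀ d → Linear (monomial T d)
  monomial-linear L []       = id-linear
  monomial-linear L (d ∷ ds) = ∘-linear (iterate-linear d (L zero)) (monomial-linear (L ∘ suc) ds)

  act-linear : ∀ {n} {T : Fin n → Op A} → (∀ i → Linear (T i)) → ∀ p → Linear (act T p)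
  act-linear {T = T} L p .resp-≗ eq a =
    sumOver-cong p (λ (q , d) → cong (q *_) (resp-≗ (monomial-linear L d) eq a))
  act-linear {T = T} L p .resp-+ φ ψ a = trans
    (sumOver-cong p (λ (q , d) → trans (cong (q *_) (resp-+ (monomial-linear L d) φ ψ a))
      (ℚ.*-distribˡ-+ q (monomial T d φ a) (monomial T d ψ a))))
    (sumOver-+ p (λ (q , d) → q * monomial T d φ a) (λ (q , d) → q * monomial T d ψ a))
  act-linear {T = T} L []            .resp-* c ψ a = sym (ℚ.*-zeroʳ c)
  act-linear {T = T} L ((q , d) ∷ p) .resp-* c ψ a = trans
    (cong₂ _+_ (cong (q *_) (resp-* (monomial-linear L d) c ψ a)) (act-linear L p .resp-* c ψ a))
    (solve 4 (λ q c x y → q :* (c :* x) :+ c :* y := c :* (q :* x :+ y)) refl q c (monomial T d ψ a) (act T p ψ a))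

  iterate-commute : ∀ k {f g : Op A} → Linear f → Commute f g → Commute (iterate k f) g
  iterate-commute zero    F fg ψ a = refl
  iterate-commute (suc k) F fg ψ a = trans (resp-≗ F (iterate-commute k F fg ψ) a) (fg _ a)

  monomial-commute : ∀ {n} {T : Fin n → Op A} {g} → (∀ i → Linear (T i)) → (∀ i → Commute (T i) g) →
                     ∀ d → Commute (monomial T d) g
  monomial-commute         L Tg []       ψ a = refl
  monomial-commute {T = T} L Tg (d ∷ ds) ψ a =
    trans (resp-≗ (iterate-linear d (L zero)) (monomial-commute (L ∘ suc) (Tg ∘ suc) ds ψ) a)
          (iterate-commute d (L zero) (Tg zero) _ a)

  iterate-+ : ∀ j k (f : Op A) ψ → iterate (j ℕ.+ k) f ψ ≡ iterate j f (iterate k f ψ)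
  iterate-+ zero    k f ψ = refl
  iterate-+ (suc j) k f ψ = cong f (iterate-+ j k f ψ)

  monomial-0 : ∀ {n} (T : Fin n → Op A) ψ → monomial T (replicate n 0) ψ ≡ ψ
  monomial-0 {zero}  T ψ = refl
  monomial-0 {suc n} T ψ = monomial-0 (T ∘ suc) ψ

  monomial-tabulate-0 : ∀ {n} (T : Fin n → Op A) ψ → monomial T (tabulate (λ _ → 0)) ψ ≡ ψ
  monomial-tabulate-0 {zero}  T ψ = refl
  monomial-tabulate-0 {suc n} T ψ = monomial-tabulate-0 (T ∘ suc) ψ

  monomial-var : ∀ {n} (T : Fin n → Op A) i ψ →
                 monomial T (tabulate (λ j → if does (i ≟ᶠ j) then 1 else 0)) ψ ≡ T i ψ
  monomial-var T zero    ψ = cong (T zero) (monomial-tabulate-0 (T ∘ suc) ψ)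
  monomial-var T (suc i) ψ = monomial-var (T ∘ suc) i ψ

  act-const : ∀ {n} (T : Fin n → Op A) q ψ a → act T (const q) ψ a ≡ q * ψ a
  act-const T q ψ a = trans (ℚ.+-identityʳ _) (cong (λ φ → q * φ a) (monomial-0 T ψ))

  act-var : ∀ {n} (T : Fin n → Op A) i ψ → act T (var i) ψ ≗ T i ψ
  act-var T i ψ a = trans (ℚ.+-identityʳ _) (trans (ℚ.*-identityˡ _) (cong (λ φ → φ a) (monomial-var T i ψ)))

  act-⊕ : ∀ {n} (T : Fin n → Op A) p q ψ a → act T (p ⊕ q) ψ a ≡ act T p ψ a + act T q ψ a
  act-⊕ T []            q ψ a = sym (ℚ.+-identityˡ _)
  act-⊕ T ((c , d) ∷ p) q ψ a =
    trans (cong (c * monomial T d ψ a +_) (act-⊕ T p q ψ a)) (sym (ℚ.+-assoc (c * monomial T d ψ a) _ _))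

  -- Commutativity enters here: the power `e` of the first operator has to move past the monomial
  -- `ds` in the remaining ones.
  monomial-+ : ∀ {n} {T : Fin n → Op A} → (∀ i → Linear (T i)) → (∀ i j → Commute (T i) (T j)) → ∀ d e ψ →
               monomial T (zipWith ℕ._+_ d e) ψ ≗ monomial T d (monomial T e ψ)
  monomial-+         L comm []       []       ψ a = refl
  monomial-+ {T = T} L comm (d ∷ ds) (e ∷ es) ψ a = begin
    iterate (d ℕ.+ e) f (monomial T′ (zipWith ℕ._+_ ds es) ψ) a
      ≡⟨ cong (λ φ → φ a) (iterate-+ d e f _) ⟩
    iterate d f (iterate e f (monomial T′ (zipWith ℕ._+_ ds es) ψ)) a
      ≡⟨ resp-≗ (∘-linear (iterate-linear d (L zero)) (iterate-linear e (L zero)))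
           (monomial-+ (L ∘ suc) (λ i j → comm (suc i) (suc j)) ds es ψ) a ⟩
    iterate d f (iterate e f (monomial T′ ds (monomial T′ es ψ))) a
      ≡⟨ resp-≗ (iterate-linear d (L zero))
           (iterate-commute e (L zero) (λ φ b → sym (monomial-commute (L ∘ suc) (λ i → comm (suc i) zero) ds φ b)) _) a ⟩
    iterate d f (monomial T′ ds (iterate e f (monomial T′ es ψ))) a ∎
    where
    open ≡-Reasoning
    f = T zero
    T′ = T ∘ suc

  module _ {n : ℕ} {T : Fin n → Op A} (linear : ∀ i → Linear (T i)) (comm : ∀ i j → Commute (T i) (T j)) where

    act-term-⊗ : ∀ c d q ψ a →
      act T (map (λ (r , e) → c * r , zipWith ℕ._+_ d e) q) ψ a ≡ c * monomial T d (act T q ψ) a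
    act-term-⊗ c d []            ψ a =
      sym (trans (cong (c *_) (resp-0 (monomial-linear linear d) a)) (ℚ.*-zeroʳ c))
    act-term-⊗ c d ((r , e) ∷ q) ψ a = begin
      c * r * monomial T (zipWith ℕ._+_ d e) ψ a + act T (map _ q) ψ a
        ≡⟨ cong₂ _+_ (cong (c * r *_) (monomial-+ linear comm d e ψ a)) (act-term-⊗ c d q ψ a) ⟩
      c * r * M (monomial T e ψ) a + c * M (act T q ψ) a
        ≡⟨ solve 4 (λ c r x y → c :* r :* x :+ c :* y := c :* (r :* x :+ y)) refl c r _ _ ⟩
      c * (r * M (monomial T e ψ) a + M (act T q ψ) a)
        ≡⟨ cong (λ t → c * (t + M (act T q ψ) a)) (resp-* (monomial-linear linear d) r _ a) ⟨
      c * (M (λ b → r * monomial T e ψ b) a + M (act T q ψ) a)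
        ≡⟨ cong (c *_) (resp-+ (monomial-linear linear d) _ _ a) ⟨
      c * M (act T ((r , e) ∷ q) ψ) a ∎
      where
      open ≡-Reasoning
      M = monomial T d

    act-⊗ : ∀ p q ψ → act T (p ⊗ q) ψ ≗ act T p (act T q ψ)
    act-⊗ []            q ψ a = refl
    act-⊗ ((c , d) ∷ p) q ψ a =
      trans (act-⊕ T (map _ q) (p ⊗ q) ψ a) (cong₂ _+_ (act-term-⊗ c d q ψ a) (act-⊗ p q ψ a))

    act-⊖ : ∀ p q ψ a → act T (p ⊖ q) ψ a ≡ act T p ψ a + - act T q ψ a
    act-⊖ p q ψ a = trans (act-⊕ T p _ ψ a) (cong (act T p ψ a +_)
      (trans (act-⊗ (const (- 1ℚ)) q ψ a) (trans (act-const T (- 1ℚ) _ a)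
        (trans (sym (ℚ.neg-distribˡ-* 1ℚ (act T q ψ a))) (cong -_ (ℚ.*-identityˡ (act T q ψ a)))))))

    -- If the generators act as zero, the action factors through the quotient ring. The clause for
    -- `resp` is the reason for proving that the action is invariant under `_≈_`.
    act-Ideal : {G : Pred (Poly n) 0ℓ} → (∀ {g} → G g → ∀ ψ a → act T g ψ a ≡ 0ℚ) →
                ∀ {p} → Ideal G p → ∀ ψ a → act T p ψ a ≡ 0ℚ
    act-Ideal h (gen g)         ψ a = h g ψ a
    act-Ideal h zero            ψ a = trans (act-const T 0ℚ ψ a) (ℚ.*-zeroˡ (ψ a))
    act-Ideal h (add {p} {q} I J) ψ a =
      trans (act-⊕ T p q ψ a) (cong₂ _+_ (act-Ideal h I ψ a) (act-Ideal h J ψ a))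
    act-Ideal h (mul r {p} I)   ψ a = trans (act-⊗ r p ψ a)
      (trans (resp-≗ (act-linear linear r) (act-Ideal h I ψ) a) (resp-0 (act-linear linear r) a))
    act-Ideal h (resp {p} {q} p≈q I) ψ a =
      trans (sym (linearExtension-cong (λ d → monomial T d ψ a) {p} {q} p≈q)) (act-Ideal h I ψ a)

    act-∏ : {B : Set} (f : B → Fin n) (xs : List B) →
            ∀ ψ → act T (∏ (map (var ∘ f) xs)) ψ ≗ foldr (T ∘ f) ψ xs
    act-∏ f []       ψ a = trans (act-const T 1ℚ ψ a) (ℚ.*-identityˡ _)
    act-∏ f (x ∷ xs) ψ a = trans (act-⊗ (var (f x)) (∏ (map (var ∘ f) xs)) ψ a)
      (trans (act-var T (f x) (act T (∏ (map (var ∘ f) xs)) ψ) a) (resp-≗ (linear (f x)) (act-∏ f xs ψ) a))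

-- The operators xᵢ

-- K lists the vertices to the right of the current edge: p earlier edges
-- belong to its block, and y is the value of ψ after merging at the left end
-- of that block.
slope : ∀ {m} → ℕ → ℚ → Subset m → (Subset m → ℚ) → Fin (suc m) → ℚ
slope p y []          ψ zero    = recip p * (0ℚ + - y)
slope p y (false ∷ K) ψ zero    = recip p * (ψ (true ∷ K) + - y)
slope p y (false ∷ K) ψ (suc i) = slope 0 (ψ (true ∷ K)) K (ψ ∘ (false ∷_)) i
slope p y (true ∷ K)  ψ zero    = slope (suc p) y K (ψ ∘ (true ∷_)) zero
slope p y (true ∷ K)  ψ (suc i) = slope (suc p) y K (ψ ∘ (true ∷_)) i

-- The initial value `0ℚ` is the convention ψ(K ∪ {0}) = 0. The convention at the other end n of the
-- path is the `0ℚ` in the clause of `slope` for `[]`.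
X : ∀ {m} → Fin (suc m) → Op (Subset m)
X i ψ K = slope 0 0ℚ K ψ i

-- Apart from `y`, `slope` reads its function only at the sets `K [ u ]≔ true`, which all contain
-- `K`. Hence properties that persist when `K` is enlarged pass through `X i`; flatness and the
-- quadratic relations rely on this.
slope-cong : ∀ {m} p {y y′} (K : Subset m) {φ ψ} → y ≡ y′ →
             (∀ u → lookup K u ≡ false → φ (K [ u ]≔ true) ≡ ψ (K [ u ]≔ true)) →
             slope p y K φ ≗ slope p y′ K ψ
slope-cong p []          refl eq zero    = refl
slope-cong p (false ∷ K) refl eq zero    = cong (λ t → recip p * (t + _)) (eq zero refl)
slope-cong p (false ∷ K) refl eq (suc i) = slope-cong 0 K (eq zero refl) (eq ∘ suc) i
slope-cong p (true ∷ K)  refl eq zero    = slope-cong (suc p) K refl (eq ∘ suc) zero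
slope-cong p (true ∷ K)  refl eq (suc i) = slope-cong (suc p) K refl (eq ∘ suc) i

-- Linearity has to be joint in `ψ` and `y`, since each new block replaces `y` by a value of `ψ`.
slope-+ : ∀ {m} p y y′ (K : Subset m) φ ψ i →
          slope p (y + y′) K (λ K → φ K + ψ K) i ≡ slope p y K φ i + slope p y′ K ψ i
slope-+ p y y′ []          φ ψ zero    =
  solve 3 (λ r y z → r :* (con 0ℚ :+ :- (y :+ z)) := r :* (con 0ℚ :+ :- y) :+ r :* (con 0ℚ :+ :- z)) refl (recip p) y y′
slope-+ p y y′ (false ∷ K) φ ψ zero    =
  solve 5 (λ r a b y z → r :* (a :+ b :+ :- (y :+ z)) := r :* (a :+ :- y) :+ r :* (b :+ :- z)) refl
    (recip p) (φ (true ∷ K)) (ψ (true ∷ K)) y y′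
slope-+ p y y′ (false ∷ K) φ ψ (suc i) = slope-+ 0 _ _ K (φ ∘ (false ∷_)) (ψ ∘ (false ∷_)) i
slope-+ p y y′ (true ∷ K)  φ ψ zero    = slope-+ (suc p) y y′ K (φ ∘ (true ∷_)) (ψ ∘ (true ∷_)) zero
slope-+ p y y′ (true ∷ K)  φ ψ (suc i) = slope-+ (suc p) y y′ K (φ ∘ (true ∷_)) (ψ ∘ (true ∷_)) i

slope-* : ∀ {m} p c y (K : Subset m) ψ i →
          slope p (c * y) K (λ K → c * ψ K) i ≡ c * slope p y K ψ i
slope-* p c y []          ψ zero    =
  solve 3 (λ r c y → r :* (con 0ℚ :+ :- (c :* y)) := c :* (r :* (con 0ℚ :+ :- y))) refl (recip p) c y
slope-* p c y (false ∷ K) ψ zero    =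
  solve 4 (λ r c a y → r :* (c :* a :+ :- (c :* y)) := c :* (r :* (a :+ :- y))) refl (recip p) c (ψ (true ∷ K)) y
slope-* p c y (false ∷ K) ψ (suc i) = slope-* 0 c _ K (ψ ∘ (false ∷_)) i
slope-* p c y (true ∷ K)  ψ zero    = slope-* (suc p) c y K (ψ ∘ (true ∷_)) zero
slope-* p c y (true ∷ K)  ψ (suc i) = slope-* (suc p) c y K (ψ ∘ (true ∷_)) i

X-linear : ∀ {m} (i : Fin (suc m)) → Linear (X i)
X-linear i .resp-≗ eq K  = slope-cong 0 K refl (λ u _ → eq (K [ u ]≔ true)) i
X-linear i .resp-+ φ ψ K =
  trans (slope-cong 0 K (sym (ℚ.+-identityˡ 0ℚ)) (λ _ _ → refl) i) (slope-+ 0 0ℚ 0ℚ K φ ψ i)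
X-linear i .resp-* c ψ K =
  trans (slope-cong 0 K (sym (ℚ.*-zeroʳ c)) (λ _ _ → refl) i) (slope-* 0 c 0ℚ K ψ i)

-- Constancy on blocks and sums up to block ends

Flat : ∀ {m} → Subset m → (Fin (suc m) → ℚ) → Set
Flat K g = ∀ j → lookup K j ≡ true → g (inject₁ j) ≡ g (suc j)

-- The two edges at a vertex of `K` lead to the same recursive call of `slope`.
slope-flat : ∀ {m} p y (K : Subset m) ψ → Flat K (slope p y K ψ)
slope-flat p y (true ∷ K)  ψ zero    _   = refl
slope-flat p y (false ∷ K) ψ (suc j) j∈K = slope-flat 0 _ K (ψ ∘ (false ∷_)) j j∈K
slope-flat p y (true ∷ K)  ψ (suc zero)    j∈K = slope-flat (suc p) y K (ψ ∘ (true ∷_)) zero j∈K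
slope-flat p y (true ∷ K)  ψ (suc (suc j)) j∈K = slope-flat (suc p) y K (ψ ∘ (true ∷_)) (suc j) j∈K

prefixSum : ∀ {n} → (Fin n → ℚ) → Fin n → ℚ
prefixSum g zero    = g zero
prefixSum g (suc i) = g zero + prefixSum (g ∘ suc) i

prefixSum-cong : ∀ {n} {g h : Fin n → ℚ} → g ≗ h → prefixSum g ≗ prefixSum h
prefixSum-cong eq zero    = eq zero
prefixSum-cong eq (suc i) = cong₂ _+_ (eq zero) (prefixSum-cong (eq ∘ suc) i)

prefixSum-+ : ∀ {n} (g h : Fin n → ℚ) i → prefixSum (λ k → g k + h k) i ≡ prefixSum g i + prefixSum h i
prefixSum-+ g h zero    = refl
prefixSum-+ g h (suc i) = trans (cong (g zero + h zero +_) (prefixSum-+ (g ∘ suc) (h ∘ suc) i))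
  (solve 4 (λ a b c d → a :+ b :+ (c :+ d) := a :+ c :+ (b :+ d)) refl (g zero) (h zero) _ _)

prefixSum-swap : ∀ {m n} (f : Fin m → Fin n → ℚ) u v →
  prefixSum (λ i → prefixSum (f i) v) u ≡ prefixSum (λ j → prefixSum (λ i → f i j) u) v
prefixSum-swap f zero    v = refl
prefixSum-swap f (suc u) v =
  trans (cong (prefixSum (f zero) v +_) (prefixSum-swap (f ∘ suc) u v))
        (sym (prefixSum-+ (f zero) (λ j → prefixSum (λ i → f (suc i) j) u) v))

prefixSum-linear : ∀ {A : Set} {n} {f : Op A} → Linear f → (T : Fin n → A → ℚ) → ∀ v a →
                   f (λ b → prefixSum (λ j → T j b) v) a ≡ prefixSum (λ j → f (T j) a) v
prefixSum-linear F T zero    a = refl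
prefixSum-linear {f = f} F T (suc v) a =
  trans (resp-+ F (T zero) _ a) (cong (f (T zero) a +_) (prefixSum-linear F (T ∘ suc) v a))

-- Edge u is a stop if it ends its block; merge u then joins that block to the
-- next one, with value 0 at the end of the path.
Stop : ∀ {m} → Subset m → Fin (suc m) → Set
Stop []      zero    = ⊤
Stop (k ∷ K) zero    = k ≡ false
Stop (k ∷ K) (suc u) = Stop K u

merge : ∀ {m} → Fin (suc m) → Op (Subset m)
merge zero    ψ []      = 0ℚ
merge zero    ψ (k ∷ K) = ψ (true ∷ K)
merge (suc u) ψ (k ∷ K) = merge u (ψ ∘ (k ∷_)) K

-- The `p` edges already passed and the current one, each of slope x/(p+1), together rise by x.
block-rise : ∀ p x → ν p * (recip p * x) + recip p * x ≡ x
block-rise p x = begin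
  ν p * (recip p * x) + recip p * x
    ≡⟨ solve 3 (λ n r x → n :* (r :* x) :+ r :* x := r :* (con 1ℚ :+ n) :* x) refl (ν p) (recip p) x ⟩
  recip p * (1ℚ + ν p) * x          ≡⟨ cong (λ t → recip p * t * x) (ν-suc p) ⟨
  recip p * ν (suc p) * x           ≡⟨ cong (_* x) (recip-inverse p) ⟩
  1ℚ * x                            ≡⟨ ℚ.*-identityˡ x ⟩
  x                                 ∎
  where open ≡-Reasoning

-- The first summand accounts for the `p` earlier edges of the block, so the sum runs from the left
-- end of that block to `u`. Each block rises by the difference of the values at its two ends, and
-- the sum telescopes.
slope-prefixSum : ∀ {m} p y (K : Subset m) ψ u → Stop K u →
  ν p * slope p y K ψ zero + prefixSum (slope p y K ψ) u ≡ merge u ψ K + - y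
slope-prefixSum p y []          ψ zero    _    = block-rise p (0ℚ + - y)
slope-prefixSum p y (false ∷ K) ψ zero    _    = block-rise p (ψ (true ∷ K) + - y)
slope-prefixSum p y (false ∷ K) ψ (suc u) stop = begin
  ν p * s + (s + P)
    -- The next block has no earlier edges, so the induction hypothesis carries the summand
    -- `0ℚ * t`.
    ≡⟨ solve 4 (λ n s P t → n :* s :+ (s :+ P) := n :* s :+ s :+ (con 0ℚ :* t :+ P)) refl (ν p) s P t ⟩
  ν p * s + s + (0ℚ * t + P)
    ≡⟨ cong₂ _+_ (block-rise p (D + - y)) (slope-prefixSum 0 D K ψ′ u stop) ⟩
  D + - y + (merge u ψ′ K + - D)
    ≡⟨ solve 3 (λ D y M → D :+ :- y :+ (M :+ :- D) := M :+ :- y) refl D y (merge u ψ′ K) ⟩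
  merge u ψ′ K + - y ∎
  where
  open ≡-Reasoning
  D = ψ (true ∷ K)
  ψ′ = ψ ∘ (false ∷_)
  s = recip p * (D + - y)
  t = slope 0 D K ψ′ zero
  P = prefixSum (slope 0 D K ψ′) u
slope-prefixSum p y (true ∷ K)  ψ (suc u) stop = begin
  ν p * t + (t + P)
    ≡⟨ solve 3 (λ n t P → n :* t :+ (t :+ P) := (con 1ℚ :+ n) :* t :+ P) refl (ν p) t P ⟩
  (1ℚ + ν p) * t + P   ≡⟨ cong (λ n → n * t + P) (ν-suc p) ⟨
  ν (suc p) * t + P    ≡⟨ slope-prefixSum (suc p) y K ψ′ u stop ⟩
  merge u ψ′ K + - y   ∎
  where
  open ≡-Reasoning
  ψ′ = ψ ∘ (true ∷_)
  t = slope (suc p) y K ψ′ zero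
  P = prefixSum (slope (suc p) y K ψ′) u

-- The telescoped sum started at vertex 0. Thus x₁ + ⋯ + x_k acts at sets without k by adjoining k,
-- which is dual to multiplying a product of such partial sums by one further factor.
X-prefixSum : ∀ {m} (K : Subset m) ψ u → Stop K u → prefixSum (λ i → X i ψ K) u ≡ merge u ψ K
X-prefixSum K ψ u stop = begin
  P                   ≡⟨ solve 2 (λ t P → P := con 0ℚ :* t :+ P) refl (X zero ψ K) P ⟩
  0ℚ * X zero ψ K + P ≡⟨ slope-prefixSum 0 0ℚ K ψ u stop ⟩
  merge u ψ K + - 0ℚ  ≡⟨ ℚ.+-identityʳ (merge u ψ K) ⟩
  merge u ψ K         ∎
  where
  open ≡-Reasoning
  P = prefixSum (λ i → X i ψ K) u

head-unique : ∀ p {x y} → ν p * x + x ≡ ν p * y + y → x ≡ y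
head-unique p {x} {y} eq = begin
  x                       ≡⟨ rise x ⟨
  recip p * (ν p * x + x) ≡⟨ cong (recip p *_) eq ⟩
  recip p * (ν p * y + y) ≡⟨ rise y ⟩
  y                       ∎
  where
  open ≡-Reasoning
  rise : ∀ x → recip p * (ν p * x + x) ≡ x
  rise x = trans (solve 3 (λ n r x → r :* (n :* x :+ x) := n :* (r :* x) :+ r :* x) refl (ν p) (recip p) x)
                 (block-rise p x)

-- Uniqueness in a discrete Dirichlet problem: the prefix sums are piecewise
-- linear with prescribed values at the block ends.
flat-unique : ∀ {m} p (K : Subset m) {g h} → Flat K g → Flat K h →
  (∀ u → Stop K u → ν p * g zero + prefixSum g u ≡ ν p * h zero + prefixSum h u) → g ≗ h
flat-unique p []          G H eq zero = head-unique p (eq zero tt)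
flat-unique p (false ∷ K) G H eq zero = head-unique p (eq zero refl)
flat-unique p (false ∷ K) {g} {h} G H eq (suc i) =
  flat-unique 0 K {g ∘ suc} {h ∘ suc} (G ∘ suc) (H ∘ suc) eq′ i
  where
  drop : ∀ n s t P → 0ℚ * t + P ≡ n * s + (s + P) + - (n * s + s)
  drop = solve 4 (λ n s t P → con 0ℚ :* t :+ P := n :* s :+ (s :+ P) :+ :- (n :* s :+ s)) refl
  eq′ : ∀ u → Stop K u → 0ℚ * g (suc zero) + prefixSum (g ∘ suc) u ≡ 0ℚ * h (suc zero) + prefixSum (h ∘ suc) u
  eq′ u stop = trans (drop (ν p) (g zero) (g (suc zero)) (prefixSum (g ∘ suc) u))
    (trans (cong₂ (λ a b → a + - b) (eq (suc u) stop) (eq zero refl))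
           (sym (drop (ν p) (h zero) (h (suc zero)) (prefixSum (h ∘ suc) u))))
flat-unique p (true ∷ K) {g} {h} G H eq = λ where
    zero    → trans (G zero refl) (trans (tail zero) (sym (H zero refl)))
    (suc i) → tail i
  where
  shift : ∀ g → Flat (true ∷ K) g → ∀ u →
          ν (suc p) * g (suc zero) + prefixSum (g ∘ suc) u ≡ ν p * g zero + prefixSum g (suc u)
  shift g G u = trans
    (cong₂ (λ n s → n * s + prefixSum (g ∘ suc) u) (ν-suc p) (sym (G zero refl)))
    (solve 3 (λ n t P → (con 1ℚ :+ n) :* t :+ P := n :* t :+ (t :+ P)) refl (ν p) (g zero) _)
  tail : g ∘ suc ≗ h ∘ suc
  tail = flat-unique (suc p) K {g ∘ suc} {h ∘ suc} (G ∘ suc) (H ∘ suc)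
    (λ u stop → trans (shift g G u) (trans (eq (suc u) stop) (sym (shift h H u))))

-- Merging blocks, and commutation of the operators

merge-cong : ∀ {m} (u : Fin (suc m)) {φ ψ} → φ ≗ ψ → merge u φ ≗ merge u ψ
merge-cong zero    eq []      = refl
merge-cong zero    eq (k ∷ K) = eq (true ∷ K)
merge-cong (suc u) eq (k ∷ K) = merge-cong u (eq ∘ (k ∷_)) K

merge-comm : ∀ {m} (u v : Fin (suc m)) → Commute (merge u) (merge v)
merge-comm zero    zero    ψ K       = refl
merge-comm zero    (suc v) ψ (k ∷ K) = refl
merge-comm (suc u) zero    ψ (k ∷ K) = refl
merge-comm (suc u) (suc v) ψ (k ∷ K) = merge-comm u v (ψ ∘ (k ∷_)) K

-- Adjoining a vertex `u` different from `v` leaves `v` a stop, so the hypothesis still applies to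
-- the enlarged set.
merge-cong-Stop : ∀ {m} {u v : Fin (suc m)} → u ≢ v → ∀ {φ ψ} → (∀ K → Stop K v → φ K ≡ ψ K) →
                  ∀ K → Stop K v → merge u φ K ≡ merge u ψ K
merge-cong-Stop {u = zero}  {zero}  u≢v eq K       stop = contradiction refl u≢v
merge-cong-Stop {u = zero}  {suc v} u≢v eq (k ∷ K) stop = eq (true ∷ K) stop
merge-cong-Stop {u = suc u} {zero}  u≢v eq (k ∷ K) stop = merge-cong u (λ K → eq (k ∷ K) stop) K
merge-cong-Stop {u = suc u} {suc v} u≢v eq (k ∷ K) stop =
  merge-cong-Stop {u = u} {v} (u≢v ∘ cong suc) (eq ∘ (k ∷_)) K stop

lookup-insert : ∀ {m} (K : Subset m) u {j} → lookup K j ≡ true → lookup (K [ u ]≔ true) j ≡ true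
lookup-insert (k ∷ K) zero    {zero}  j∈K = refl
lookup-insert (k ∷ K) zero    {suc j} j∈K = j∈K
lookup-insert (k ∷ K) (suc u) {zero}  j∈K = j∈K
lookup-insert (k ∷ K) (suc u) {suc j} j∈K = lookup-insert K u j∈K

X-flat : ∀ {m} (K : Subset m) ψ → Flat K (λ i → X i ψ K)
X-flat K ψ = slope-flat 0 0ℚ K ψ

XX-flat : ∀ {m} (K : Subset m) ψ i → Flat K (λ j → X i (X j ψ) K)
XX-flat K ψ i j j∈K =
  slope-cong 0 K refl (λ u _ → X-flat (K [ u ]≔ true) ψ j (lookup-insert K u j∈K)) i

-- Both orders give functions of (i , j) that are flat in each variable, so it
-- suffices to compare their prefix sums at pairs of stops, where merge commutes.
X-comm : ∀ {m} (i j : Fin (suc m)) → Commute (X i) (X j)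
X-comm i j ψ K = flat-unique 0 K {F i} {λ j → F j i} (XX-flat K ψ i) (λ v v∈K → X-flat K (X i ψ) v v∈K)
  (λ v stop → cong₂ _+_ (trans (ℚ.*-zeroˡ (F i zero)) (sym (ℚ.*-zeroˡ (F zero i)))) (row v stop i)) j
  where
  open ≡-Reasoning
  F : Fin _ → Fin _ → ℚ
  F i j = X i (X j ψ) K

  rect : ∀ u v → u ≢ v → Stop K u → Stop K v → prefixSum (λ i → prefixSum (F i) v) u ≡ merge u (merge v ψ) K
  rect u v u≢v stop-u stop-v = begin
    prefixSum (λ i → prefixSum (F i) v) u
      ≡⟨ prefixSum-cong (λ i → prefixSum-linear (X-linear i) (λ j → X j ψ) v K) u ⟨
    prefixSum (λ i → X i (λ K → prefixSum (λ j → X j ψ K) v) K) u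
      ≡⟨ X-prefixSum K _ u stop-u ⟩
    merge u (λ K → prefixSum (λ j → X j ψ K) v) K
      ≡⟨ merge-cong-Stop u≢v (λ K → X-prefixSum K ψ v) K stop-v ⟩
    merge u (merge v ψ) K ∎

  rect-sym : ∀ u v → Stop K u → Stop K v →
    prefixSum (λ i → prefixSum (F i) v) u ≡ prefixSum (λ i → prefixSum (λ j → F j i) v) u
  rect-sym u v stop-u stop-v with u ≟ᶠ v
  -- After merging at `u`, edge `u` is no longer a stop, so `rect` does not cover the diagonal.
  -- There the region of summation is a square, and interchanging the two sums is enough.
  ... | yes refl = prefixSum-swap F u u
  ... | no  u≢v  = begin
    prefixSum (λ i → prefixSum (F i) v) u          ≡⟨ rect u v u≢v stop-u stop-v ⟩
    merge u (merge v ψ) K                          ≡⟨ merge-comm u v ψ K ⟩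
    merge v (merge u ψ) K                          ≡⟨ rect v u (u≢v ∘ sym) stop-v stop-u ⟨
    prefixSum (λ j → prefixSum (F j) u) v          ≡⟨ prefixSum-swap F v u ⟩
    prefixSum (λ i → prefixSum (λ j → F j i) v) u  ∎

  row : ∀ v → Stop K v → ∀ i → prefixSum (F i) v ≡ prefixSum (λ j → F j i) v
  row v stop-v = flat-unique 0 K
    (λ u u∈K → prefixSum-cong (λ j → X-flat K (X j ψ) u u∈K) v)
    (λ u u∈K → prefixSum-cong (λ j → XX-flat K ψ j u u∈K) v)
    (λ u stop-u → cong₂ _+_ (trans (ℚ.*-zeroˡ (prefixSum (F zero) v)) (sym (ℚ.*-zeroˡ (prefixSum (λ j → F j zero) v))))
                            (rect-sym u v stop-u stop-v))

-- The relations

act-∑-var : ∀ {A : Set} {n} (T : Fin n → Op A) xs ψ a →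
            act T (∑ (map var xs)) ψ a ≡ sumOver xs (λ i → T i ψ a)
act-∑-var T []       ψ a = trans (act-const T 0ℚ ψ a) (ℚ.*-zeroˡ (ψ a))
act-∑-var T (x ∷ xs) ψ a =
  trans (act-⊕ T (var x) (∑ (map var xs)) ψ a) (cong₂ _+_ (act-var T x ψ a) (act-∑-var T xs ψ a))

sumOver-filter : {A : Set} {P : Pred A 0ℓ} (P? : Decidable P) (xs : List A) (g : A → ℚ) →
                 sumOver (filter P? xs) g ≡ sumOver xs (λ x → if does (P? x) then g x else 0ℚ)
sumOver-filter P? []       g = refl
sumOver-filter P? (x ∷ xs) g with does (P? x)
... | true  = cong (g x +_) (sumOver-filter P? xs g)
... | false = trans (sumOver-filter P? xs g) (sym (ℚ.+-identityˡ _))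

sumOver-tabulate : ∀ {A : Set} {n} (f : Fin (suc n) → A) (g : A → ℚ) →
                   sumOver (tabulateᴸ f) g ≡ prefixSum (g ∘ f) (fromℕ n)
sumOver-tabulate {n = zero}  f g = ℚ.+-identityʳ _
sumOver-tabulate {n = suc n} f g = cong (g (f zero) +_) (sumOver-tabulate (f ∘ suc) g)

≤?-suc : ∀ {m n} (i : Fin m) (k : Fin n) → does (suc i ≤? suc k) ≡ does (i ≤? k)
≤?-suc zero    k = refl
≤?-suc (suc i) k = refl

prefixSum-0 : ∀ {n} (i : Fin n) → prefixSum (λ _ → 0ℚ) i ≡ 0ℚ
prefixSum-0 zero    = refl
prefixSum-0 (suc i) = trans (ℚ.+-identityˡ _) (prefixSum-0 i)

prefixSum-truncate : ∀ {m} (k : Fin m) (g : Fin (suc m) → ℚ) →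
  prefixSum (λ i → if does (i ≤? k) then g i else 0ℚ) (fromℕ m) ≡ prefixSum g (inject₁ k)
prefixSum-truncate {suc m} zero    g = trans (cong (g zero +_) (prefixSum-0 (fromℕ m))) (ℚ.+-identityʳ _)
prefixSum-truncate {suc m} (suc k) g = cong (g zero +_) (trans
  (prefixSum-cong (λ i → cong (λ b → if b then g (suc i) else 0ℚ) (≤?-suc i k)) (fromℕ m))
  (prefixSum-truncate k (g ∘ suc)))

act-partialSum : ∀ {A : Set} {m} (T : Fin (suc m) → Op A) (k : Fin m) ψ a →
                 act T (partialSum k) ψ a ≡ prefixSum (λ i → T i ψ a) (inject₁ k)
act-partialSum {m = m} T k ψ a = begin
  act T (partialSum k) ψ a
    ≡⟨ act-∑-var T (filter (_≤? k) (allFin (suc m))) ψ a ⟩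
  sumOver (filter (_≤? k) (allFin (suc m))) (λ i → T i ψ a)
    ≡⟨ sumOver-filter (_≤? k) (allFin (suc m)) (λ i → T i ψ a) ⟩
  sumOver (allFin (suc m)) (λ i → if does (i ≤? k) then T i ψ a else 0ℚ)
    ≡⟨ sumOver-tabulate {n = m} id (λ i → if does (i ≤? k) then T i ψ a else 0ℚ) ⟩
  prefixSum (λ i → if does (i ≤? k) then T i ψ a else 0ℚ) (fromℕ m)
    ≡⟨ prefixSum-truncate k (λ i → T i ψ a) ⟩
  prefixSum (λ i → T i ψ a) (inject₁ k) ∎
  where open ≡-Reasoning

Stop-last : ∀ {m} (K : Subset m) → Stop K (fromℕ m)
Stop-last []      = _
Stop-last (k ∷ K) = Stop-last K

merge-last : ∀ {m} ψ (K : Subset m) → merge (fromℕ m) ψ K ≡ 0ℚ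
merge-last ψ []      = refl
merge-last ψ (k ∷ K) = merge-last (ψ ∘ (k ∷_)) K

Stop-inject₁ : ∀ {m} (K : Subset m) j → lookup K j ≡ false → Stop K (inject₁ j)
Stop-inject₁ (k ∷ K) zero    j∉K = j∉K
Stop-inject₁ (k ∷ K) (suc j) j∉K = Stop-inject₁ K j j∉K

merge-inject₁ : ∀ {m} ψ (K : Subset m) j → merge (inject₁ j) ψ K ≡ ψ (K [ j ]≔ true)
merge-inject₁ ψ (k ∷ K) zero    = refl
merge-inject₁ ψ (k ∷ K) (suc j) = merge-inject₁ (ψ ∘ (k ∷_)) K j

-- The linear relation holds because the total rise along the path is 0. For the quadratic one, x_k
-- - x_{k+1} kills every value at a set containing k, by flatness. If k is not in `K`, the partial
-- sum evaluates this difference at `K` with k adjoined; if k is in `K`, it evaluates it only at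
-- sets containing `K`.
act-Generator : ∀ {m g} → Generator m g → ∀ ψ K → act X g ψ K ≡ 0ℚ
act-Generator {m} linear ψ K = begin
  act X (∑ (map var (allFin (suc m)))) ψ K      ≡⟨ act-∑-var X (allFin (suc m)) ψ K ⟩
  sumOver (allFin (suc m)) (λ i → X i ψ K)      ≡⟨ sumOver-tabulate {n = m} id (λ i → X i ψ K) ⟩
  prefixSum (λ i → X i ψ K) (fromℕ m)           ≡⟨ X-prefixSum K ψ (fromℕ m) (Stop-last K) ⟩
  merge (fromℕ m) ψ K                           ≡⟨ merge-last ψ K ⟩
  0ℚ                                            ∎
  where open ≡-Reasoning
act-Generator {m} (quadratic k) ψ K = begin
  act X (partialSum k ⊗ d) ψ K                        ≡⟨ act-⊗ X-linear X-comm (partialSum k) d ψ K ⟩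
  act X (partialSum k) (act X d ψ) K                  ≡⟨ act-partialSum X k (act X d ψ) K ⟩
  prefixSum (λ i → X i (act X d ψ) K) (inject₁ k)     ≡⟨ vanishes ⟩
  0ℚ ∎
  where
  open ≡-Reasoning
  d = var (inject₁ k) ⊖ var (suc k)
  difference : ∀ K → act X d ψ K ≡ X (inject₁ k) ψ K + - X (suc k) ψ K
  difference K = trans (act-⊖ X-linear X-comm (var (inject₁ k)) (var (suc k)) ψ K)
    (cong₂ (λ a b → a + - b) (act-var X (inject₁ k) ψ K) (act-var X (suc k) ψ K))
  difference-flat : ∀ {K} → lookup K k ≡ true → act X d ψ K ≡ 0ℚ
  difference-flat {K} k∈K = trans (difference K)
    (trans (cong (_+ - X (suc k) ψ K) (X-flat K ψ k k∈K)) (ℚ.+-inverseʳ (X (suc k) ψ K)))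
  vanishes : prefixSum (λ i → X i (act X d ψ) K) (inject₁ k) ≡ 0ℚ
  vanishes with lookup K k in eq
  ... | false = begin
    prefixSum (λ i → X i (act X d ψ) K) (inject₁ k) ≡⟨ X-prefixSum K _ (inject₁ k) (Stop-inject₁ K k eq) ⟩
    merge (inject₁ k) (act X d ψ) K                 ≡⟨ merge-inject₁ (act X d ψ) K k ⟩
    act X d ψ (K [ k ]≔ true)                       ≡⟨ difference-flat (lookup∘update k K true) ⟩
    0ℚ                                              ∎
  ... | true = trans (prefixSum-cong (λ i → trans
      (slope-cong 0 K refl (λ u _ → difference-flat (lookup-insert K u eq)) i)
      (resp-0 (X-linear i) K)) (inject₁ k)) (prefixSum-0 (inject₁ k))

-- Integrality and leading terms

m!n!∣[m+n]! : ∀ m n → m ! ℕ.* n ! ∣ (m ℕ.+ n) !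
m!n!∣[m+n]! m n = subst (λ k → m ! ℕ.* k ! ∣ (m ℕ.+ n) !) (ℕ.m+n∸m≡n m n) (k![n∸k]!∣n! (ℕ.m≤m+n m n))

-- The product of (|β| - 1)! over the blocks β, the first of which has p extra edges.
weight : ∀ {m} → ℕ → Subset m → ℕ
weight p []          = p !
weight p (false ∷ K) = p ! ℕ.* weight 0 K
weight p (true ∷ K)  = weight (suc p) K

weight≢0 : ∀ {m} p (K : Subset m) → NonZero (weight p K)
weight≢0 p []          = p ℕ.!≢0
weight≢0 p (false ∷ K) = ℕ.m*n≢0 (p !) (weight 0 K) {{p ℕ.!≢0}} {{weight≢0 0 K}}
weight≢0 p (true ∷ K)  = weight≢0 (suc p) K

-- Only the factor of the first block differs between the two weights, and the quotient is a
-- binomial coefficient.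
weight-split : ∀ {m} a b (K : Subset m) → a ! ℕ.* weight b K ∣ weight (a ℕ.+ b) K
weight-split a b []          = m!n!∣[m+n]! a b
weight-split a b (false ∷ K) = subst (_∣ (a ℕ.+ b) ! ℕ.* weight 0 K) (ℕ.*-assoc (a !) (b !) (weight 0 K))
  (ℕ.*-monoˡ-∣ (weight 0 K) (m!n!∣[m+n]! a b))
weight-split a b (true ∷ K)  = subst (λ c → a ! ℕ.* weight (suc b) K ∣ weight c K) (ℕ.+-suc a b)
  (weight-split a (suc b) K)

-- The block to the left of the current one has q + 1 edges, and c is the
-- weight of everything before it.
slope-integral : ∀ {m} c q p {y} (K : Subset m) {ψ} → (∀ K′ → c ℕ.* q ! ℕ.* weight p K′ ∣ℚ ψ K′) →
  c ℕ.* weight (suc (p ℕ.+ q)) K ∣ℚ y → ∀ i → c ℕ.* q ! ℕ.* weight p K ∣ℚ slope p y K ψ i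
slope-integral c q p [] hψ hy zero =
  ∣ℚ-recip p (∣ℚ-+ (∣ℚ-0 (suc p ℕ.* (c ℕ.* q ! ℕ.* p !))) (∣ℚ-neg (∣ℚ-trans d hy)))
  where
  -- Merging blocks of q + 1 and p + 1 edges gives weight (p + q + 1)!. Since (p + 1) p! = (p + 1)!,
  -- the quotient is again a binomial coefficient.
  d : suc p ℕ.* (c ℕ.* q ! ℕ.* p !) ∣ c ℕ.* (suc (p ℕ.+ q)) !
  d = subst (_∣ c ℕ.* (suc (p ℕ.+ q)) !)
    (solveℕ 4 (λ s c f g → c :× ((s :× g) :× f) :≡ s :× (c :× f :× g)) refl (suc p) c (q !) (p !))
    (ℕ.*-monoʳ-∣ c (m!n!∣[m+n]! (suc p) q))
slope-integral c q p (false ∷ K) hψ hy zero =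
  ∣ℚ-recip p (∣ℚ-+ (∣ℚ-trans d₁ (hψ (true ∷ K))) (∣ℚ-neg (∣ℚ-trans d₂ hy)))
  where
  -- Merging on the right lengthens the next block by p + 1 edges, so `weight-split` supplies the
  -- factor (p + 1)! = (p + 1) p!.
  d₁ : suc p ℕ.* (c ℕ.* q ! ℕ.* (p ! ℕ.* weight 0 K)) ∣ c ℕ.* q ! ℕ.* weight (suc p) K
  d₁ = subst₂ _∣_
    (solveℕ 4 (λ s C g w → C :× ((s :× g) :× w) :≡ s :× (C :× (g :× w))) refl (suc p) (c ℕ.* q !) (p !) (weight 0 K))
    (cong (λ r → c ℕ.* q ! ℕ.* weight r K) (ℕ.+-identityʳ (suc p)))
    (ℕ.*-monoʳ-∣ (c ℕ.* q !) (weight-split (suc p) 0 K))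
  d₂ : suc p ℕ.* (c ℕ.* q ! ℕ.* (p ! ℕ.* weight 0 K)) ∣ c ℕ.* ((suc (p ℕ.+ q)) ! ℕ.* weight 0 K)
  d₂ = subst (_∣ c ℕ.* ((suc (p ℕ.+ q)) ! ℕ.* weight 0 K))
    (solveℕ 5 (λ s c f g w → c :× ((s :× g) :× f :× w) :≡ s :× (c :× f :× (g :× w))) refl (suc p) c (q !) (p !) (weight 0 K))
    (ℕ.*-monoʳ-∣ c (ℕ.*-monoˡ-∣ (weight 0 K) (m!n!∣[m+n]! (suc p) q)))
slope-integral c q p (false ∷ K) {ψ} hψ hy (suc i) =
  subst (_∣ℚ slope 0 (ψ (true ∷ K)) K (ψ ∘ (false ∷_)) i) (ℕ.*-assoc (c ℕ.* q !) (p !) (weight 0 K))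
    (slope-integral (c ℕ.* q !) p 0 K
      (λ K′ → subst (_∣ℚ ψ (false ∷ K′)) (sym (ℕ.*-assoc (c ℕ.* q !) (p !) (weight 0 K′))) (hψ (false ∷ K′)))
      (hψ (true ∷ K)) i)
slope-integral c q p (true ∷ K) hψ hy zero    = slope-integral c q (suc p) K (hψ ∘ (true ∷_)) hy zero
slope-integral c q p (true ∷ K) hψ hy (suc i) = slope-integral c q (suc p) K (hψ ∘ (true ∷_)) hy i

Integral : ∀ {m} → (Subset m → ℚ) → Set
Integral ψ = ∀ K → weight 0 K ∣ℚ ψ K

X-integral : ∀ {m} (i : Fin (suc m)) {ψ} → Integral ψ → Integral (X i ψ)
X-integral i {ψ} hψ K = subst (_∣ℚ X i ψ K) (ℕ.+-identityʳ _)
  -- The first block has no left neighbour. A fictitious one with a single edge, `c` = 1 and `q` =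
  -- 0, contributes weight 1, and the merged value is the boundary value 0.
  (slope-integral 1 0 0 K (λ K′ → subst (_∣ℚ ψ K′) (sym (ℕ.+-identityʳ _)) (hψ K′)) (∣ℚ-0 _) i)

weight-empty : ∀ {m} p (K : Subset m) → (∀ j → lookup K j ≡ false) → weight p K ≡ p !
weight-empty p []          h = refl
weight-empty p (false ∷ K) h = trans (cong (p ! ℕ.*_) (weight-empty 0 K (h ∘ suc))) (ℕ.*-identityʳ (p !))
weight-empty p (true ∷ K)  h with h zero
... | ()

Below : ∀ {m} → Subset m → Fin m → Set
Below K l = ∀ j → toℕ l ≤ toℕ j → lookup K j ≡ false

-- Edge `inject₁ l` ends at vertex `l`, the right end of its block, and the left end contributes 0
-- by hypothesis. As `K` has nothing from `l` on, adjoining `l` joins this block to a single edge.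
-- This multiplies the weight by the length of the block, which cancels the denominator of the
-- slope.
slope-leading : ∀ {m} p (K : Subset m) φ l → Below K l → (∀ a → toℕ a < toℕ l → φ (K [ a ]≔ true) ≡ 0ℚ) →
  ν (weight p (K [ l ]≔ true)) * slope p 0ℚ K φ (inject₁ l) ≡ ν (weight p K) * φ (K [ l ]≔ true)
slope-leading p (true ∷ K)  φ zero    below _ with below zero z≤n
... | ()
slope-leading p (false ∷ K) φ zero    below _ = begin
  ν (weight (suc p) K) * (recip p * (D + - 0ℚ)) ≡⟨ cong (λ w → ν w * (recip p * (D + - 0ℚ))) (weight-empty (suc p) K empty) ⟩
  ν (suc p ℕ.* p !) * (recip p * (D + - 0ℚ))    ≡⟨ cong₂ (λ n x → n * (recip p * x)) (ν-* (suc p) (p !)) (ℚ.+-identityʳ D) ⟩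
  ν (suc p) * ν (p !) * (recip p * D)
    ≡⟨ solve 4 (λ s f r D → s :* f :* (r :* D) := r :* s :* (f :* D)) refl (ν (suc p)) (ν (p !)) (recip p) D ⟩
  recip p * ν (suc p) * (ν (p !) * D)           ≡⟨ cong (_* (ν (p !) * D)) (recip-inverse p) ⟩
  1ℚ * (ν (p !) * D)                            ≡⟨ ℚ.*-identityˡ _ ⟩
  ν (p !) * D                                   ≡⟨ cong (λ w → ν w * D) (weight-empty p (false ∷ K) (λ j → below j z≤n)) ⟨
  ν (weight p (false ∷ K)) * D                  ∎
  where
  open ≡-Reasoning
  D = φ (true ∷ K)
  empty : ∀ j → lookup K j ≡ false
  empty j = below (suc j) z≤n
slope-leading p (false ∷ K) φ (suc l) below small = begin
  ν (p ! ℕ.* w′) * slope 0 (φ (true ∷ K)) K φ′ (inject₁ l)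
    ≡⟨ cong₂ _*_ (ν-* (p !) w′) (slope-cong 0 K (small zero (s≤s z≤n)) (λ _ _ → refl) (inject₁ l)) ⟩
  ν (p !) * ν w′ * slope 0 0ℚ K φ′ (inject₁ l)
    ≡⟨ ℚ.*-assoc (ν (p !)) (ν w′) _ ⟩
  ν (p !) * (ν w′ * slope 0 0ℚ K φ′ (inject₁ l))
    ≡⟨ cong (ν (p !) *_) (slope-leading 0 K φ′ l (λ j l≤j → below (suc j) (s≤s l≤j)) (λ a a<l → small (suc a) (s≤s a<l))) ⟩
  ν (p !) * (ν (weight 0 K) * φ′ (K [ l ]≔ true))
    ≡⟨ ℚ.*-assoc (ν (p !)) (ν (weight 0 K)) _ ⟨
  ν (p !) * ν (weight 0 K) * φ′ (K [ l ]≔ true)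
    ≡⟨ cong (_* φ′ (K [ l ]≔ true)) (ν-* (p !) (weight 0 K)) ⟨
  ν (p ! ℕ.* weight 0 K) * φ′ (K [ l ]≔ true) ∎
  where
  open ≡-Reasoning
  φ′ = φ ∘ (false ∷_)
  w′ = weight 0 (K [ l ]≔ true)
slope-leading p (true ∷ K)  φ (suc l) below small =
  slope-leading (suc p) K (φ ∘ (true ∷_)) l (λ j l≤j → below (suc j) (s≤s l≤j)) (λ a a<l → small (suc a) (s≤s a<l))

-- The binary code orders subsets by their largest differing element.
bit : Bool → ℕ
bit false = 0
bit true  = 1

code : ∀ {m} → Subset m → ℕ
code []      = 0
code (k ∷ K) = bit k ℕ.+ 2 ℕ.* code K

listCode : ∀ {m} → List (Fin m) → ℕ
listCode = foldr (λ l s → 2 ^ toℕ l ℕ.+ s) 0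

insertAll : ∀ {m} → List (Fin m) → Subset m → Subset m
insertAll []       K = K
insertAll (l ∷ ls) K = insertAll ls (K [ l ]≔ true)

-- A structurally recursive form of the filtered list in the definition of `x[_]`, convenient for
-- induction on the subset.
members : ∀ {m} → Subset m → List (Fin m)
members []          = []
members (false ∷ L) = map suc (members L)
members (true ∷ L)  = zero ∷ map suc (members L)

-- Only an inequality, because the code does not grow when `l` already belongs to `K`.
code-insert : ∀ {m} (K : Subset m) l → code (K [ l ]≔ true) ≤ code K ℕ.+ 2 ^ toℕ l
code-insert (false ∷ K) zero    = ℕ.≤-reflexive (ℕ.+-comm 1 _)
code-insert (true ∷ K)  zero    = ℕ.m≤m+n _ 1
code-insert (k ∷ K)     (suc l) = begin
  bit k ℕ.+ 2 ℕ.* code (K [ l ]≔ true)          ≤⟨ ℕ.+-monoʳ-≤ (bit k) (ℕ.*-monoʳ-≤ 2 (code-insert K l)) ⟩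
  bit k ℕ.+ 2 ℕ.* (code K ℕ.+ 2 ^ toℕ l)        ≡⟨ cong (bit k ℕ.+_) (ℕ.*-distribˡ-+ 2 (code K) _) ⟩
  bit k ℕ.+ (2 ℕ.* code K ℕ.+ 2 ^ suc (toℕ l))  ≡⟨ ℕ.+-assoc (bit k) _ _ ⟨
  bit k ℕ.+ 2 ℕ.* code K ℕ.+ 2 ^ suc (toℕ l)    ∎
  where open ℕ.≤-Reasoning

code-insertAll : ∀ {m} ls (K : Subset m) → code (insertAll ls K) ≤ code K ℕ.+ listCode ls
code-insertAll []       K = ℕ.m≤m+n (code K) 0
code-insertAll (l ∷ ls) K = begin
  code (insertAll ls (K [ l ]≔ true))            ≤⟨ code-insertAll ls (K [ l ]≔ true) ⟩
  code (K [ l ]≔ true) ℕ.+ listCode ls           ≤⟨ ℕ.+-monoˡ-≤ (listCode ls) (code-insert K l) ⟩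
  code K ℕ.+ 2 ^ toℕ l ℕ.+ listCode ls           ≡⟨ ℕ.+-assoc (code K) _ _ ⟩
  code K ℕ.+ (2 ^ toℕ l ℕ.+ listCode ls)         ∎
  where open ℕ.≤-Reasoning

code-injective : ∀ {m} (K L : Subset m) → code K ≡ code L → K ≡ L
code-injective []          []          eq = refl
code-injective (false ∷ K) (false ∷ L) eq = cong (false ∷_) (code-injective K L (ℕ.*-cancelˡ-≡ _ _ 2 eq))
code-injective (true ∷ K)  (true ∷ L)  eq = cong (true ∷_) (code-injective K L (ℕ.*-cancelˡ-≡ _ _ 2 (ℕ.suc-injective eq)))
code-injective (false ∷ K) (true ∷ L)  eq = contradiction eq (ℕ.even≢odd (code K) (code L))
code-injective (true ∷ K)  (false ∷ L) eq = contradiction (sym eq) (ℕ.even≢odd (code L) (code K))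

code<2^m : ∀ {m} (K : Subset m) → code K < 2 ^ m
code<2^m []      = s≤s z≤n
code<2^m {suc m} (k ∷ K) = begin-strict
  bit k ℕ.+ 2 ℕ.* code K    <⟨ ℕ.+-monoˡ-< (2 ℕ.* code K) (s≤s (bit≤1 k)) ⟩
  2 ℕ.+ 2 ℕ.* code K        ≡⟨ ℕ.*-suc 2 (code K) ⟨
  2 ℕ.* suc (code K)        ≤⟨ ℕ.*-monoʳ-≤ 2 (code<2^m K) ⟩
  2 ^ suc m                 ∎
  where
  open ℕ.≤-Reasoning
  bit≤1 : ∀ k → bit k ≤ 1
  bit≤1 false = z≤n
  bit≤1 true  = s≤s z≤n

Below-insert : ∀ {m} {K : Subset m} {l} a → toℕ a < toℕ l → Below K l → Below (K [ a ]≔ true) l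
Below-insert {K = K} {l} a a<l below j l≤j = trans (lookup∘update′ j≢a K true) (below j l≤j)
  where
  j≢a : j ≢ a
  j≢a refl = ℕ.<⇒≱ a<l l≤j

ν-weight-cancelˡ : ∀ {m} (K : Subset m) {x y} → ν (weight 0 K) * x ≡ ν (weight 0 K) * y → x ≡ y
ν-weight-cancelˡ K = ν-cancelˡ (weight 0 K) {{weight≢0 0 K}}

X* : ∀ {m} → List (Fin m) → Op (Subset m)
X* ls ψ = foldr (X ∘ inject₁) ψ ls

X*-integral : ∀ {m} (ls : List (Fin m)) {ψ} → Integral ψ → Integral (X* ls ψ)
X*-integral []       h = h
X*-integral (l ∷ ls) h = X-integral (inject₁ l) (X*-integral ls h)

-- Induction on the list, applying `slope-leading` to the outermost operator; the weights telescope.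
-- The vanishing it demands at `K` with some a < `l` adjoined comes from the same induction: the
-- value there is proportional to a value of `ψ` at a set of code below `N`.
X*-leading : ∀ {m} N {ψ : Subset m → ℚ} → (∀ K → code K < N → ψ K ≡ 0ℚ) →
  ∀ ls K → AllPairs (λ a b → toℕ a < toℕ b) ls → All (Below K) ls → code K ℕ.+ listCode ls ≤ N →
  ν (weight 0 (insertAll ls K)) * X* ls ψ K ≡ ν (weight 0 K) * ψ (insertAll ls K)
X*-leading N         small []       K _ _ _ = refl
X*-leading N {ψ} small (l ∷ ls) K (l<ls ∷ sorted) (below ∷ belows) bound =
  -- The weight of `K` with `l` adjoined links `slope-leading` to the induction hypothesis, so it is
  -- multiplied in and cancelled at the end.
  ν-weight-cancelˡ (K [ l ]≔ true) (begin
    ν w′ * (ν w″ * X (inject₁ l) φ K)     ≡⟨ swap (ν w′) (ν w″) _ ⟩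
    ν w″ * (ν w′ * X (inject₁ l) φ K)     ≡⟨ cong (ν w″ *_) (slope-leading 0 K φ l below lower) ⟩
    ν w″ * (ν w * φ (K [ l ]≔ true))      ≡⟨ swap (ν w″) (ν w) _ ⟩
    ν w * (ν w″ * φ (K [ l ]≔ true))      ≡⟨ cong (ν w *_) (IH l ℕ.≤-refl bound) ⟩
    ν w * (ν w′ * ψ (insertAll (l ∷ ls) K)) ≡⟨ swap (ν w) (ν w′) _ ⟩
    ν w′ * (ν w * ψ (insertAll (l ∷ ls) K)) ∎)
  where
  open ≡-Reasoning
  φ = X* ls ψ
  w = weight 0 K
  w′ = weight 0 (K [ l ]≔ true)
  w″ = weight 0 (insertAll (l ∷ ls) K)
  swap : ∀ a b c → a * (b * c) ≡ b * (a * c)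
  swap = solve 3 (λ a b c → a :* (b :* c) := b :* (a :* c)) refl

  code-step : ∀ a → code (K [ a ]≔ true) ℕ.+ listCode ls ≤ code K ℕ.+ listCode (a ∷ ls)
  code-step a = ℕ.≤-trans (ℕ.+-monoˡ-≤ (listCode ls) (code-insert K a))
    (ℕ.≤-reflexive (ℕ.+-assoc (code K) (2 ^ toℕ a) (listCode ls)))

  -- Needed at a = `l` for the leading term and at a < `l` for the vanishing.
  IH : ∀ a → toℕ a ≤ toℕ l → code K ℕ.+ listCode (a ∷ ls) ≤ N →
       ν (weight 0 (insertAll ls (K [ a ]≔ true))) * φ (K [ a ]≔ true) ≡
       ν (weight 0 (K [ a ]≔ true)) * ψ (insertAll ls (K [ a ]≔ true))
  IH a a≤l bound = X*-leading N small ls (K [ a ]≔ true) sorted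
    (All.zipWith (λ (l<b , below) → Below-insert {K = K} a (ℕ.≤-<-trans a≤l l<b) below) (l<ls , belows))
    (ℕ.≤-trans (code-step a) bound)

  lower : ∀ a → toℕ a < toℕ l → φ (K [ a ]≔ true) ≡ 0ℚ
  lower a a<l = ν-weight-cancelˡ (insertAll ls (K [ a ]≔ true)) (begin
    _ ≡⟨ IH a (ℕ.<⇒≤ a<l) (ℕ.<⇒≤ lt) ⟩
    ν v * ψ (insertAll ls (K [ a ]≔ true))
      ≡⟨ cong (ν v *_) (small _ (ℕ.≤-<-trans (code-insertAll (a ∷ ls) K) lt)) ⟩
    ν v * 0ℚ ≡⟨ ℚ.*-zeroʳ (ν v) ⟩
    0ℚ       ≡⟨ ℚ.*-zeroʳ (ν (weight 0 (insertAll ls (K [ a ]≔ true)))) ⟨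
    ν (weight 0 (insertAll ls (K [ a ]≔ true))) * 0ℚ ∎)
    where
    v = weight 0 (K [ a ]≔ true)
    -- Replacing `l` by a smaller vertex lowers the corresponding power of 2 strictly.
    lt : code K ℕ.+ listCode (a ∷ ls) < N
    lt = ℕ.<-≤-trans (ℕ.+-monoʳ-< (code K) (ℕ.+-monoˡ-< (listCode ls) (ℕ.^-monoʳ-< 2 (s≤s (s≤s z≤n)) a<l))) bound

-- Structure constants

filter-∈?-suc : ∀ {m} b (L : Subset m) xs → filter (_∈? (b ∷ L)) (map suc xs) ≡ map suc (filter (_∈? L) xs)
filter-∈?-suc b L []       = refl
filter-∈?-suc b L (x ∷ xs) with does (x ∈? L)
... | true  = cong (suc x ∷_) (filter-∈?-suc b L xs)
... | false = filter-∈?-suc b L xs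

filter-∈?-allFin : ∀ {m} (L : Subset m) → filter (_∈? L) (allFin m) ≡ members L
filter-∈?-allFin []      = refl
filter-∈?-allFin {suc m} (b ∷ L) with tail
  where
  tail : filter (_∈? (b ∷ L)) (tabulateᴸ suc) ≡ map suc (members L)
  tail = trans (cong (filter (_∈? (b ∷ L))) (sym (map-tabulate id suc)))
    (trans (filter-∈?-suc b L (allFin m)) (cong (map suc) (filter-∈?-allFin L)))
filter-∈?-allFin (false ∷ L) | tail = tail
filter-∈?-allFin (true ∷ L)  | tail = cong (zero ∷_) tail

listCode-suc : ∀ {m} (ls : List (Fin m)) → listCode (map suc ls) ≡ 2 ℕ.* listCode ls
listCode-suc []       = refl
listCode-suc (l ∷ ls) = trans (cong (2 ^ suc (toℕ l) ℕ.+_) (listCode-suc ls))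
  (sym (ℕ.*-distribˡ-+ 2 (2 ^ toℕ l) (listCode ls)))

listCode-members : ∀ {m} (L : Subset m) → listCode (members L) ≡ code L
listCode-members []          = refl
listCode-members (false ∷ L) = trans (listCode-suc (members L)) (cong (2 ℕ.*_) (listCode-members L))
listCode-members (true ∷ L)  = cong suc (trans (listCode-suc (members L)) (cong (2 ℕ.*_) (listCode-members L)))

insertAll-suc : ∀ {m} k (ls : List (Fin m)) K → insertAll (map suc ls) (k ∷ K) ≡ k ∷ insertAll ls K
insertAll-suc k []       K = refl
insertAll-suc k (l ∷ ls) K = insertAll-suc k ls (K [ l ]≔ true)

insertAll-members : ∀ {m} (L : Subset m) → insertAll (members L) ⊥ ≡ L
insertAll-members []          = refl
insertAll-members (false ∷ L) = trans (insertAll-suc false (members L) ⊥) (cong (false ∷_) (insertAll-members L))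
insertAll-members (true ∷ L)  = trans (insertAll-suc true (members L) ⊥) (cong (true ∷_) (insertAll-members L))

members-sorted : ∀ {m} (L : Subset m) → AllPairs (λ a b → toℕ a < toℕ b) (members L)
members-sorted []          = []
members-sorted (false ∷ L) = AllPairs.map⁺ (AllPairs.map s≤s (members-sorted L))
members-sorted (true ∷ L)  = All.map⁺ (All.universal (λ _ → s≤s z≤n) (members L)) ∷
                             AllPairs.map⁺ (AllPairs.map s≤s (members-sorted L))

code-⊥ : ∀ m → code (⊥ {m}) ≡ 0
code-⊥ zero    = refl
code-⊥ (suc m) = cong (2 ℕ.*_) (code-⊥ m)

weight-⊥ : ∀ m → weight 0 (⊥ {m}) ≡ 1
weight-⊥ m = weight-empty 0 (⊥ {m}) (λ j → lookup-replicate j false)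

act-x : ∀ {m} (L : Subset m) ψ → act X x[ L ] ψ ≗ X* (members L) ψ
act-x {m} L ψ K = trans (act-∏ X-linear X-comm inject₁ (filter (_∈? L) (allFin m)) ψ K)
  (cong (λ ls → X* ls ψ K) (filter-∈?-allFin L))

act-x-integral : ∀ {m} (L : Subset m) {ψ} → Integral ψ → Integral (act X x[ L ] ψ)
act-x-integral L {ψ} h K = subst (weight 0 K ∣ℚ_) (sym (act-x L ψ K)) (X*-integral (members L) h K)

Integral-⊥ : ∀ {m} {ψ : Subset m → ℚ} → Integral ψ → IsInteger (ψ ⊥)
Integral-⊥ {m} {ψ} h = 1∣ℚ⇒IsInteger (subst (_∣ℚ ψ ⊥) (weight-⊥ m) (h ⊥))

-- `X*-leading` started at `⊥`, which has weight 1 and code 0, so that the bound `N` = `code L` is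
-- attained exactly.
act-x-leading : ∀ {m} (L : Subset m) {ψ} → (∀ K → code K < code L → ψ K ≡ 0ℚ) →
                ν (weight 0 L) * act X x[ L ] ψ ⊥ ≡ ψ L
act-x-leading {m} L {ψ} small = begin
  ν (weight 0 L) * act X x[ L ] ψ ⊥
    ≡⟨ cong₂ (λ K x → ν (weight 0 K) * x) (sym (insertAll-members L)) (act-x L ψ ⊥) ⟩
  ν (weight 0 (insertAll (members L) ⊥)) * X* (members L) ψ ⊥
    ≡⟨ X*-leading (code L) small (members L) ⊥ (members-sorted L)
         (All.universal (λ _ j _ → lookup-replicate j false) (members L))
         (ℕ.≤-reflexive (cong₂ ℕ._+_ (code-⊥ m) (listCode-members L))) ⟩
  ν (weight 0 (⊥ {m})) * ψ (insertAll (members L) ⊥)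
    ≡⟨ cong₂ (λ w K → ν w * ψ K) (weight-⊥ m) (insertAll-members L) ⟩
  1ℚ * ψ L
    ≡⟨ ℚ.*-identityˡ (ψ L) ⟩
  ψ L ∎
  where open ≡-Reasoning

-- Test functions for the square free monomials

_≟ˢ_ : ∀ {m} → DecidableEquality (Subset m)
_≟ˢ_ = ≡-dec Bool._≟_

-- The smallest positive multiple of the indicator function of `L` that is `Integral`. The scaling
-- makes the diagonal pairing with `x[ L ]` equal to 1.
δ : ∀ {m} → Subset m → Subset m → ℚ
δ L K = if does (K ≟ˢ L) then ν (weight 0 L) else 0ℚ

δ-≡ : ∀ {m} (L : Subset m) → δ L L ≡ ν (weight 0 L)
δ-≡ L with L ≟ˢ L
... | yes _  = refl
... | no L≢L = contradiction refl L≢L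

δ-≢ : ∀ {m} {L K : Subset m} → K ≢ L → δ L K ≡ 0ℚ
δ-≢ {L = L} {K} K≢L with K ≟ˢ L
... | yes K≡L = contradiction K≡L K≢L
... | no _    = refl

δ-integral : ∀ {m} (L : Subset m) → Integral (δ L)
δ-integral L K with K ≟ˢ L
... | yes refl = multiple (ℤ.+ 1) (sym (ℚ.*-identityˡ _))
... | no _     = ∣ℚ-0 (weight 0 K)

δ-below : ∀ {m} (L : Subset m) K → code K < code L → δ L K ≡ 0ℚ
δ-below L K K<L = δ-≢ {L = L} {K} λ { refl → ℕ.<-irrefl refl K<L }

act-x-δ-diagonal : ∀ {m} (L : Subset m) → act X x[ L ] (δ L) ⊥ ≡ 1ℚ
act-x-δ-diagonal L = ν-weight-cancelˡ L
  (trans (act-x-leading L (δ-below L)) (trans (δ-≡ L) (sym (ℚ.*-identityʳ _))))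

-- The leading term is taken at `K`, not at `L`: `δ L` vanishes at `K` and at every set of smaller
-- code.
act-x-δ-below : ∀ {m} (L K : Subset m) → code K < code L → act X x[ K ] (δ L) ⊥ ≡ 0ℚ
act-x-δ-below L K K<L = ν-weight-cancelˡ K (trans
  (act-x-leading K (λ K′ K′<K → δ-below L K′ (ℕ.<-trans K′<K K<L)))
  (trans (δ-below L K K<L) (sym (ℚ.*-zeroʳ (ν (weight 0 K))))))

IsInteger-cancelʳ : ∀ {x y} → IsInteger (x + y) → IsInteger y → IsInteger x
IsInteger-cancelʳ {x} {y} h hy = subst IsInteger
  (solve 2 (λ x y → x :+ y :+ :- y := x) refl x y) (IsInteger-+ h (IsInteger-neg hy))

IsInteger-cancelˡ : ∀ {x y} → IsInteger (x + y) → IsInteger x → IsInteger y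
IsInteger-cancelˡ {x} {y} h = IsInteger-cancelʳ (subst IsInteger (ℚ.+-comm x y) h)

sumOver-++ : {A : Set} (xs ys : List A) (g : A → ℚ) → sumOver (xs ++ ys) g ≡ sumOver xs g + sumOver ys g
sumOver-++ []       ys g = sym (ℚ.+-identityˡ _)
sumOver-++ (x ∷ xs) ys g = trans (cong (g x +_) (sumOver-++ xs ys g)) (sym (ℚ.+-assoc (g x) _ _))

sumOver-allSubsets : ∀ {m} (g : Subset (suc m) → ℚ) → sumOver (allSubsets (suc m)) g ≡
  sumOver (allSubsets m) (g ∘ (false ∷_)) + sumOver (allSubsets m) (g ∘ (true ∷_))
sumOver-allSubsets {m} g = trans (sumOver-++ (map (false ∷_) (allSubsets m)) _ g)
  (cong₂ _+_ (foldr-map _ (false ∷_) 0ℚ (allSubsets m)) (foldr-map _ (true ∷_) 0ℚ (allSubsets m)))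

sumOver-integer : {A : Set} (xs : List A) {g : A → ℚ} → (∀ x → IsInteger (g x)) → IsInteger (sumOver xs g)
sumOver-integer []       h = IsInteger-0
sumOver-integer (x ∷ xs) h = IsInteger-+ (h x) (sumOver-integer xs h)

-- The recursion follows the two halves of `allSubsets`. The half that does not contain `L` has an
-- integral sum and is subtracted.
isolate-integer : ∀ {m} (L : Subset m) {g} → (∀ K → K ≢ L → IsInteger (g K)) →
                  IsInteger (sumOver (allSubsets m) g) → IsInteger (g L)
isolate-integer []          {g} h s = subst IsInteger (ℚ.+-identityʳ (g [])) s
isolate-integer (false ∷ L) {g} h s = isolate-integer L (λ K K≢L → h (false ∷ K) λ { refl → K≢L refl })
  (IsInteger-cancelʳ (subst IsInteger (sumOver-allSubsets g) s) (sumOver-integer (allSubsets _) (λ K → h (true ∷ K) λ ())))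
isolate-integer (true ∷ L)  {g} h s = isolate-integer L (λ K K≢L → h (true ∷ K) λ { refl → K≢L refl })
  (IsInteger-cancelˡ (subst IsInteger (sumOver-allSubsets g) s) (sumOver-integer (allSubsets _) (λ K → h (false ∷ K) λ ())))

act-combination : ∀ {m} (c : Subset m → ℚ) Ls ψ K →
  act X (∑ (map (λ L → const (c L) ⊗ x[ L ]) Ls)) ψ K ≡ sumOver Ls (λ L → c L * act X x[ L ] ψ K)
act-combination c []       ψ K = trans (act-const X 0ℚ ψ K) (ℚ.*-zeroˡ (ψ K))
act-combination c (L ∷ Ls) ψ K = trans
  (act-⊕ X (const (c L) ⊗ x[ L ]) (∑ (map (λ L → const (c L) ⊗ x[ L ]) Ls)) ψ K)
  (cong₂ _+_ (trans (act-⊗ X-linear X-comm (const (c L)) x[ L ] ψ K) (act-const X (c L) (act X x[ L ] ψ) K))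
             (act-combination c Ls ψ K))

act-≈ᴴ : ∀ {m} {p q : Poly (suc m)} → p ≈ᴴ q → ∀ ψ K → act X p ψ K ≡ act X q ψ K
act-≈ᴴ {p = p} {q} p≈q ψ K = x∙y⁻¹≈ε⇒x≈y ℚ.+-0-group (act X p ψ K) (act X q ψ K)
  (trans (sym (act-⊖ X-linear X-comm p q ψ K)) (act-Ideal X-linear X-comm act-Generator p≈q ψ K))

corollary4p9 : (m : ℕ) (J K : Subset m) (c : Subset m → ℚ) →
    IsStructureConstants J K c → (L : Subset m) → IsInteger (c L)
corollary4p9 m J K c h L = descend (2 ^ m) L (ℕ.m≤n+m (2 ^ m) (code L))
  where
  -- The product of `x[ J ]` and `x[ K ]` keeps `δ L` integral, and integrality at `⊥` means being
  -- an integer because the weight there is 1.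
  combination-integer : ∀ L → IsInteger (sumOver (allSubsets m) (λ L′ → c L′ * act X x[ L′ ] (δ L) ⊥))
  combination-integer L = subst IsInteger
    (trans (sym (act-⊗ X-linear X-comm x[ J ] x[ K ] (δ L) ⊥))
      (trans (act-≈ᴴ {p = x[ J ] ⊗ x[ K ]} h (δ L) ⊥) (act-combination c (allSubsets m) (δ L) ⊥)))
    (Integral-⊥ (act-x-integral J (act-x-integral K (δ-integral L))))

  -- Descending induction on the code: `d` bounds the distance from `code L` up to `2 ^ m`, which no
  -- code reaches.
  descend : ∀ d L → 2 ^ m ≤ code L ℕ.+ d → IsInteger (c L)
  descend zero    L bound = contradiction (subst (2 ^ m ≤_) (ℕ.+-identityʳ (code L)) bound) (ℕ.<⇒≱ (code<2^m L))
  descend (suc d) L bound = subst IsInteger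
    (trans (cong (c L *_) (act-x-δ-diagonal L)) (ℚ.*-identityʳ (c L)))
    (isolate-integer L others (combination-integer L))
    where
    -- Terms of smaller code vanish by triangularity; those of larger code are integers by the
    -- induction hypothesis and integrality of the pairing.
    others : ∀ L′ → L′ ≢ L → IsInteger (c L′ * act X x[ L′ ] (δ L) ⊥)
    others L′ L′≢L with ℕ.<-cmp (code L′) (code L)
    ... | tri< L′<L _ _ = subst IsInteger
      (sym (trans (cong (c L′ *_) (act-x-δ-below L L′ L′<L)) (ℚ.*-zeroʳ (c L′)))) IsInteger-0
    ... | tri≈ _ L′≡L _ = contradiction (code-injective L′ L L′≡L) L′≢L
    ... | tri> _ _ L<L′ = IsInteger-*
      (descend d L′ (ℕ.≤-trans bound (ℕ.≤-trans (ℕ.≤-reflexive (ℕ.+-suc (code L) d)) (ℕ.+-monoˡ-≤ d L<L′))))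
      (Integral-⊥ (act-x-integral L′ (δ-integral L)))
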